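{- There exists $N$ such that for every odd $n \ge N$ there exists a voting rule $\Phi : \{ -1,1\}^n \to \{ -1,1\}$ that is odd, monotone and unbiased, but not transitive-symmetric.
   Context: A voting rule on $n$ voters is a function $\Phi : \{ -1,1\}^n \to \{ -1,1\}$. It is odd if $\Phi(-x) = -\Phi(x)$ for all $x$, and monotone if $\Phi(x) \ge \Phi(x')$ whenever $x \ge x'$ coordinate-wise. A permutation $\sigma$ of $[n]$ acts on $\{ -1,1\}^n$ by permuting coordinates, and on voting rules by $(\sigma\Phi)(x) = \Phi(\sigma^{ -1}(x))$; $\mathrm{aut}(\Phi)$ is the group of permutations $\sigma$ with $\sigma\Phi = \Phi$. $\Phi$ is transitive-symmetric if for every $u, v \in [n]$ there is $\sigma \in \mathrm{aut}(\Phi)$ with $\sigma(u) = v$. For $x \in \{ -1,1\}^n$ let $x^{\oplus i}$ be $x$ with its $i$-th coordinate negated. For a probability measure $q$ on $\{ -1,1\}^n$, the influence of voter $i$ is $\mathbb{I}_i^q(\Phi) = \mathbb{P}_{x \sim q}[\Phi(x) \ne \Phi(x^{\oplus i})]$. $\Phi$ is unbiased if $\mathbb{I}_1^q(\Phi) = \cdots = \mathbb{I}_n^q(\Phi)$ for every i.i.d. measure $q = p^{\otimes n}$, where $p$ is a probability measure on $\{ -1,1\}$. -}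

module Defs where

open import Data.Fin.Base using (Fin)
open import Data.Fin.Permutation using (Permutation′; _⟨$⟩ʳ_; _⟨$⟩ˡ_; flip)
open import Data.Integer.Base as ℤ using (ℤ; _◃_)
open import Data.List.Base as List using (List; []; _∷_; cartesianProductWith; filter)
open import Data.Nat.Base as ℕ using (ℕ; zero; suc; _⊔_)
import Data.Nat.Properties as ℕ
open import Data.Product.Base using (_×_; _,_; ∃-syntax; Σ-syntax)
open import Data.Rational.Base as ℚ using (ℚ; 0ℚ; 1ℚ; ∣_∣)
import Data.Rational.Properties as ℚ
open import Data.Rational.Solver using (module +-*-Solver)
open import Data.Sign.Base as Sign using (Sign)
import Data.Sign.Properties as Sign
open import Data.Vec.Base as Vec using (Vec; lookup; tabulate; updateAt)
open import Data.Vec.Relation.Binary.Pointwise.Extensional using (Pointwise)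
open import Level using (0ℓ)
open import Relation.Binary.Core using (Rel)
open import Relation.Binary.PropositionalEquality
open import Relation.Nullary.Decidable using (¬?)
open import Relation.Unary using (Pred; Decidable)

------------------------------------------------------------------------
-- Real numbers: Cauchy sequences of rationals, up to _≃_.

Eventually : (ℕ → Set) → Set
Eventually P = ∃[ N ] (∀ m → N ℕ.≤ m → P m)

Cauchy : (ℕ → ℚ) → Set
Cauchy x = ∀ ε → 0ℚ ℚ.< ε →
           ∃[ N ] (∀ m n → N ℕ.≤ m → N ℕ.≤ n → ∣ x m ℚ.- x n ∣ ℚ.≤ ε)

record ℝ : Set where
  constructor mkℝ
  field
    seq    : ℕ → ℚ
    cauchy : Cauchy seq

open ℝ public

infix  4 _≃_ _≤ᴿ_
infixl 6 _+ᴿ_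
infixl 7 _*ᴿ_

_≃_ : Rel ℝ 0ℓ
x ≃ y = ∀ ε → 0ℚ ℚ.< ε → Eventually λ m → ∣ seq x m ℚ.- seq y m ∣ ℚ.≤ ε

_≤ᴿ_ : Rel ℝ 0ℓ
x ≤ᴿ y = ∀ ε → 0ℚ ℚ.< ε → Eventually λ m → seq x m ℚ.≤ seq y m ℚ.+ ε

private
  scaled : ∀ B → 0ℚ ℚ.< B → ∀ ε → 0ℚ ℚ.< ε → ∃[ δ ] (0ℚ ℚ.< δ × B ℚ.* δ ≡ ε)
  scaled B 0<B ε 0<ε = B⁻¹ ℚ.* ε , ℚ.positive⁻¹ _ {{ℚ.pos*pos⇒pos B⁻¹ ε}} , eq
    where
    instance
      B-pos   = ℚ.positive 0<B
      ε-pos   = ℚ.positive 0<ε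
      B≢0     = ℚ.pos⇒nonZero B
    B⁻¹ = ℚ.1/ B
    instance
      B⁻¹-pos = ℚ.1/pos⇒pos B
    eq : B ℚ.* (B⁻¹ ℚ.* ε) ≡ ε
    eq = trans (sym (ℚ.*-assoc B B⁻¹ ε))
           (trans (cong (ℚ._* ε) (ℚ.*-inverseʳ B)) (ℚ.*-identityˡ ε))

  eventuallyBounded : ∀ x → Cauchy x →
    ∃[ B ] (0ℚ ℚ.< B × Eventually λ m → ∣ x m ∣ ℚ.≤ B)
  eventuallyBounded x c with c 1ℚ (ℚ.positive⁻¹ 1ℚ)
  ... | N , close = 1ℚ ℚ.+ ∣ x N ∣ , 0<B , N , bound
    where
    0<B : 0ℚ ℚ.< 1ℚ ℚ.+ ∣ x N ∣
    0<B = ℚ.+-mono-<-≤ (ℚ.positive⁻¹ 1ℚ) (ℚ.0≤∣p∣ (x N))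

    split : ∀ a b → a ≡ (a ℚ.- b) ℚ.+ b
    split = solve 2 (λ a b → a := (a :- b) :+ b) refl
      where open +-*-Solver

    bound : ∀ m → N ℕ.≤ m → ∣ x m ∣ ℚ.≤ 1ℚ ℚ.+ ∣ x N ∣
    bound m N≤m =
      subst (λ z → ∣ z ∣ ℚ.≤ 1ℚ ℚ.+ ∣ x N ∣) (sym (split (x m) (x N)))
        (ℚ.≤-trans (ℚ.∣p+q∣≤∣p∣+∣q∣ (x m ℚ.- x N) (x N))
          (ℚ.+-monoˡ-≤ ∣ x N ∣ (close m N N≤m ℕ.≤-refl)))

  +-close : ∀ a b c d {δ} → ∣ a ℚ.- c ∣ ℚ.≤ δ → ∣ b ℚ.- d ∣ ℚ.≤ δ →
            ∣ (a ℚ.+ b) ℚ.- (c ℚ.+ d) ∣ ℚ.≤ (1ℚ ℚ.+ 1ℚ) ℚ.* δ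
  +-close a b c d {δ} p q =
    subst₂ ℚ._≤_ (cong ∣_∣ (sym (rearrange a b c d))) (double δ)
      (ℚ.≤-trans (ℚ.∣p+q∣≤∣p∣+∣q∣ (a ℚ.- c) (b ℚ.- d)) (ℚ.+-mono-≤ p q))
    where
    open +-*-Solver
    rearrange : ∀ a b c d →
      (a ℚ.+ b) ℚ.- (c ℚ.+ d) ≡ (a ℚ.- c) ℚ.+ (b ℚ.- d)
    rearrange = solve 4 (λ a b c d → (a :+ b) :- (c :+ d) := (a :- c) :+ (b :- d)) refl
    double : ∀ d → d ℚ.+ d ≡ (1ℚ ℚ.+ 1ℚ) ℚ.* d
    double = solve 1 (λ d → d :+ d := (con 1ℚ :+ con 1ℚ) :* d) refl

  ∣*∣-mono : ∀ p q {C η} → 0ℚ ℚ.< C → ∣ p ∣ ℚ.≤ C → ∣ q ∣ ℚ.≤ η →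
             ∣ p ℚ.* q ∣ ℚ.≤ C ℚ.* η
  ∣*∣-mono p q {C} {η} 0<C ∣p∣≤C ∣q∣≤η =
    subst (ℚ._≤ C ℚ.* η) (sym (ℚ.∣p*q∣≡∣p∣*∣q∣ p q))
      (ℚ.≤-trans
        (ℚ.*-monoʳ-≤-nonNeg ∣ q ∣ {{ℚ.nonNegative (ℚ.0≤∣p∣ q)}} ∣p∣≤C)
        (ℚ.*-monoˡ-≤-nonNeg C {{ℚ.nonNegative (ℚ.<⇒≤ 0<C)}} ∣q∣≤η))

  *-close : ∀ a b c d {A B δ} → 0ℚ ℚ.< A → 0ℚ ℚ.< B →
            ∣ a ∣ ℚ.≤ A → ∣ d ∣ ℚ.≤ B →
            ∣ a ℚ.- c ∣ ℚ.≤ δ → ∣ b ℚ.- d ∣ ℚ.≤ δ →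
            ∣ a ℚ.* b ℚ.- c ℚ.* d ∣ ℚ.≤ (A ℚ.+ B) ℚ.* δ
  *-close a b c d {A} {B} {δ} 0<A 0<B ∣a∣≤A ∣d∣≤B p q =
    subst₂ ℚ._≤_ (cong ∣_∣ (sym (rearrange a b c d))) (sym (ℚ.*-distribʳ-+ δ A B))
      (ℚ.≤-trans (ℚ.∣p+q∣≤∣p∣+∣q∣ (a ℚ.* (b ℚ.- d)) (d ℚ.* (a ℚ.- c)))
        (ℚ.+-mono-≤ (∣*∣-mono a (b ℚ.- d) 0<A ∣a∣≤A q)
                    (∣*∣-mono d (a ℚ.- c) 0<B ∣d∣≤B p)))
    where
    open +-*-Solver
    rearrange : ∀ a b c d →
      a ℚ.* b ℚ.- c ℚ.* d ≡ a ℚ.* (b ℚ.- d) ℚ.+ d ℚ.* (a ℚ.- c)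
    rearrange = solve 4
      (λ a b c d → a :* b :- c :* d := a :* (b :- d) :+ d :* (a :- c)) refl

  -- Abstract, so that normalising real expressions does not unfold these proofs.
  abstract
    const-cauchy : ∀ q → Cauchy (λ _ → q)
    const-cauchy q ε 0<ε = 0 , λ _ _ _ _ →
      subst (ℚ._≤ ε) (sym (cong ∣_∣ (ℚ.+-inverseʳ q))) (ℚ.<⇒≤ 0<ε)

    +-cauchy : ∀ {x y} → Cauchy x → Cauchy y → Cauchy (λ m → x m ℚ.+ y m)
    +-cauchy {x} {y} cx cy ε 0<ε =
      let δ , 0<δ , 2δ≡ε = scaled (1ℚ ℚ.+ 1ℚ) (ℚ.positive⁻¹ (1ℚ ℚ.+ 1ℚ)) ε 0<ε
          N₁ , close₁ = cx δ 0<δ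
          N₂ , close₂ = cy δ 0<δ
      in N₁ ⊔ N₂ , λ m n N≤m N≤n →
         subst (∣ (x m ℚ.+ y m) ℚ.- (x n ℚ.+ y n) ∣ ℚ.≤_) 2δ≡ε
           (+-close (x m) (y m) (x n) (y n)
             (close₁ m n (ℕ.m⊔n≤o⇒m≤o N₁ N₂ N≤m) (ℕ.m⊔n≤o⇒m≤o N₁ N₂ N≤n))
             (close₂ m n (ℕ.m⊔n≤o⇒n≤o N₁ N₂ N≤m) (ℕ.m⊔n≤o⇒n≤o N₁ N₂ N≤n)))

    *-cauchy : ∀ {x y} → Cauchy x → Cauchy y → Cauchy (λ m → x m ℚ.* y m)
    *-cauchy {x} {y} cx cy ε 0<ε =
      let A , 0<A , K , ∣x∣≤A = eventuallyBounded x cx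
          B , 0<B , L , ∣y∣≤B = eventuallyBounded y cy
          δ , 0<δ , [A+B]δ≡ε = scaled (A ℚ.+ B) (ℚ.+-mono-< 0<A 0<B) ε 0<ε
          N₁ , close₁ = cx δ 0<δ
          N₂ , close₂ = cy δ 0<δ
      in (K ⊔ L) ⊔ (N₁ ⊔ N₂) , λ m n N≤m N≤n →
         let KL≤m = ℕ.m⊔n≤o⇒m≤o (K ⊔ L) (N₁ ⊔ N₂) N≤m
             KL≤n = ℕ.m⊔n≤o⇒m≤o (K ⊔ L) (N₁ ⊔ N₂) N≤n
             N₁₂≤m = ℕ.m⊔n≤o⇒n≤o (K ⊔ L) (N₁ ⊔ N₂) N≤m
             N₁₂≤n = ℕ.m⊔n≤o⇒n≤o (K ⊔ L) (N₁ ⊔ N₂) N≤n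
         in subst (∣ x m ℚ.* y m ℚ.- x n ℚ.* y n ∣ ℚ.≤_) [A+B]δ≡ε
              (*-close (x m) (y m) (x n) (y n) 0<A 0<B
                (∣x∣≤A m (ℕ.m⊔n≤o⇒m≤o K L KL≤m))
                (∣y∣≤B n (ℕ.m⊔n≤o⇒n≤o K L KL≤n))
                (close₁ m n (ℕ.m⊔n≤o⇒m≤o N₁ N₂ N₁₂≤m) (ℕ.m⊔n≤o⇒m≤o N₁ N₂ N₁₂≤n))
                (close₂ m n (ℕ.m⊔n≤o⇒n≤o N₁ N₂ N₁₂≤m) (ℕ.m⊔n≤o⇒n≤o N₁ N₂ N₁₂≤n)))

fromℚ : ℚ → ℝ
fromℚ q = mkℝ (λ _ → q) (const-cauchy q)

0ℝ 1ℝ : ℝ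
0ℝ = fromℚ 0ℚ
1ℝ = fromℚ 1ℚ

_+ᴿ_ _*ᴿ_ : ℝ → ℝ → ℝ
x +ᴿ y = mkℝ (λ m → seq x m ℚ.+ seq y m) (+-cauchy {seq x} {seq y} (cauchy x) (cauchy y))
x *ᴿ y = mkℝ (λ m → seq x m ℚ.* seq y m) (*-cauchy {seq x} {seq y} (cauchy x) (cauchy y))

sumᴿ : List ℝ → ℝ
sumᴿ = List.foldr _+ᴿ_ 0ℝ

------------------------------------------------------------------------
-- Voting rules. Sign plays the role of {-1,1}, ordered through ±1 ∈ ℤ.

value : Sign → ℤ
value s = s ◃ 1

_≥ˢ_ : Rel Sign 0ℓ
s ≥ˢ t = value s ℤ.≥ value t

Cube : ℕ → Set
Cube n = Vec Sign n

_≥ᶜ_ : ∀ {n} → Rel (Cube n) 0ℓ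
_≥ᶜ_ = Pointwise _≥ˢ_

VotingRule : ℕ → Set
VotingRule n = Cube n → Sign

module _ {n : ℕ} where

  neg : Cube n → Cube n
  neg = Vec.map Sign.opposite

  Odd : Pred (VotingRule n) 0ℓ
  Odd Φ = ∀ x → Φ (neg x) ≡ Sign.opposite (Φ x)

  Monotone : Pred (VotingRule n) 0ℓ
  Monotone Φ = ∀ x x′ → x ≥ᶜ x′ → Φ x ≥ˢ Φ x′

  -- Left action: (σ ∙ x) at σ(i) is x at i.
  _∙_ : Permutation′ n → Cube n → Cube n
  σ ∙ x = tabulate λ i → lookup x (σ ⟨$⟩ˡ i)

  _∙ᵛ_ : Permutation′ n → VotingRule n → VotingRule n
  (σ ∙ᵛ Φ) x = Φ (flip σ ∙ x)

  aut : VotingRule n → Pred (Permutation′ n) 0ℓ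
  aut Φ σ = (σ ∙ᵛ Φ) ≗ Φ

  TransitiveSymmetric : Pred (VotingRule n) 0ℓ
  TransitiveSymmetric Φ =
    ∀ u v → Σ[ σ ∈ Permutation′ n ] (aut Φ σ × σ ⟨$⟩ʳ u ≡ v)

  _^⊕_ : Cube n → Fin n → Cube n
  x ^⊕ i = updateAt x i Sign.opposite

------------------------------------------------------------------------
-- Measures on finite sets are given by their mass functions.

signs : List Sign
signs = Sign.- ∷ Sign.+ ∷ []

cube : ∀ n → List (Cube n)
cube zero    = Vec.[] ∷ []
cube (suc n) = cartesianProductWith Vec._∷_ signs (cube n)

record ProbabilityMeasure {A : Set} (elements : List A) : Set where
  field
    mass   : A → ℝ
    nonNeg : ∀ a → 0ℝ ≤ᴿ mass a
    total  : sumᴿ (List.map mass elements) ≃ 1ℝ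

open ProbabilityMeasure public

ℙ : ∀ {n} → (Cube n → ℝ) → {E : Pred (Cube n) 0ℓ} → Decidable E → ℝ
ℙ {n} q E? = sumᴿ (List.map q (filter E? (cube n)))

influence : ∀ {n} → (Cube n → ℝ) → VotingRule n → Fin n → ℝ
influence q Φ i = ℙ q λ x → ¬? (Φ x Sign.≟ Φ (x ^⊕ i))

-- The mass function of the product measure p^{⊗n}.
_^⊗_ : ProbabilityMeasure signs → ∀ n → Cube n → ℝ
(p ^⊗ n) x = Vec.foldr′ _*ᴿ_ 1ℝ (Vec.map (mass p) x)

Unbiased : ∀ {n} → Pred (VotingRule n) 0ℓ
Unbiased {n} Φ = ∀ (p : ProbabilityMeasure signs) (i j : Fin n) →
  influence (p ^⊗ n) Φ i ≃ influence (p ^⊗ n) Φ j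

{-# OPTIONS --safe #-}
module Submission where

-- Write n = 2m + 1 and perturb the majority rule by a family L of m-sets that win (so
-- that their complements lose).  The result is odd and monotone as soon as L is
-- intersecting.  For a monotone rule the influence of i is a signed sum over the winning
-- points x of terms depending only on the weight of x and on xᵢ, so the rule is unbiased
-- as soon as every voter lies in equally many members of L.
--
-- Such an L without transitive symmetry: split the voters into m - 2 spare ones, a ring
-- ℤ/m and 3 outer ones, and take
--   A i = spare ∪ {i, i - 1},   D j = (ring ∖ {j, j - 2, j - 4}) ∪ outer,   E = ring.
-- Every voter has degree m.  The outer voters are twins (they lie in the same members),
-- whereas ring voters have no twin, so no automorphism maps an outer to a ring voter.
-- For m ≥ 7 no {i, i - 1} lies in a {j, j - 2, j - 4}, which makes A i and D j meet.

open import Defs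
open import Algebra.Bundles using (CommutativeMonoid)
import Algebra.Properties.CommutativeMonoid.Mult as Mult
import Algebra.Properties.CommutativeMonoid.Sum as FinSum
open import Data.Bool.Base using (Bool; true; false; if_then_else_)
open import Data.Empty using (⊥)
open import Data.Fin.Base as Fin using (Fin; zero; suc; toℕ; fromℕ; inject₁; _↑ˡ_; _↑ʳ_; splitAt)
open import Data.Fin.Patterns using (0F; 1F)
open import Data.Fin.Permutation using (Permutation′; permutation; flip; _⟨$⟩ʳ_)
import Data.Fin.Properties as Fin
open import Data.Fin.Relation.Unary.Top using (view; view-fromℕ; view-inject₁; ‵fromℕ; ‵inject₁)
open import Data.Integer.Base using (+≤+; -≤+; -≤-)
open import Data.List.Base as List using (List; []; _∷_; _++_; foldr; filter; length)
import Data.List.Membership.DecPropositional as DecMembership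
open import Data.List.Membership.Propositional using (_∈_; _∉_)
open import Data.List.Membership.Propositional.Properties
  using (∈-++⁺ˡ; ∈-++⁺ʳ; ∈-++⁻; ∈-tabulate⁺; ∈-tabulate⁻)
open import Data.List.Relation.Unary.All as All using ([]; _∷_)
open import Data.List.Relation.Unary.AllPairs using ([]; _∷_)
open import Data.List.Relation.Unary.Any using (here; there)
open import Data.List.Relation.Unary.Unique.Propositional using (Unique)
import Data.List.Relation.Unary.Unique.Propositional.Properties as Unique
open import Data.Nat.Base as ℕ
  using (ℕ; zero; suc; pred; _≤_; _<_; _≥_; z≤n; s≤s; _∸_; _/_; _%_; NonZero)
open import Data.Nat.Divisibility using (divides; ∣⇒≤)
open import Data.Nat.DivMod using (m≡m%n+[m/n]*n)
import Data.Nat.Properties as ℕ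
import Data.Nat.Solver as ℕ
open import Data.Product.Base as Product using (_×_; _,_; proj₁; proj₂; ∃-syntax; Σ-syntax)
open import Data.Rational.Base as ℚ using (ℚ; 0ℚ; ∣_∣; +-*-rawSemiring)
import Data.Rational.Properties as ℚ
import Data.Rational.Solver as ℚ
open import Data.Sign.Base as Sign using (Sign; opposite)
import Data.Sign.Properties as Sign
open import Data.Sum.Base using (_⊎_; inj₁; inj₂)
open import Data.Vec.Base as Vec using ([]; _∷_; lookup; replicate; tabulate)
import Data.Vec.Properties as Vec
open import Data.Vec.Relation.Binary.Pointwise.Extensional as Pointwise using (ext; module Pointwise)
open import Function.Base using (_∘_)
open import Function.Bundles using (Injection)
open import Function.Properties.Inverse using (↔⇒↣)
open import Level using (0ℓ)
open import Relation.Binary.Definitions using (DecidableEquality)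
open import Relation.Binary.PropositionalEquality
open import Relation.Nullary using (yes; no; does; ¬_; contradiction)
open import Relation.Nullary.Decidable using (¬?; dec-true; dec-false)
open import Relation.Unary using (Pred; Decidable)

open import Algebra.Definitions.RawSemiring +-*-rawSemiring using (_^_)
open import Algebra.Properties.Group ℚ.+-0-group using (∙-cancelʳ)
open FinSum ℕ.+-0-commutativeMonoid using (sum; sum-cong-≗; sum-permute; ∑-distrib-+)
open Mult ℚ.+-0-commutativeMonoid using () renaming (_×_ to _·_)

-- Finite sums over lists in a commutative monoid.

module ListSum (M : CommutativeMonoid 0ℓ 0ℓ) where
  open CommutativeMonoid M using (_≈_; ε; identityˡ; identityʳ; assoc)
    renaming (Carrier to C; _∙_ to _⊕_; ∙-cong to ⊕-cong; ∙-congˡ to ⊕-congˡ;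
              refl to ≈-refl; sym to ≈-sym; trans to ≈-trans)

  ∑[_] : {A : Set} → List A → (A → C) → C
  ∑[ xs ] f = foldr (λ x s → f x ⊕ s) ε xs

  when : Bool → C → C
  when b c = if b then c else ε

  Σ-++ : ∀ {A : Set} (xs ys : List A) f → ∑[ xs ++ ys ] f ≈ ∑[ xs ] f ⊕ ∑[ ys ] f
  Σ-++ []       ys f = ≈-sym (identityˡ _)
  Σ-++ (x ∷ xs) ys f = ≈-trans (⊕-congˡ (Σ-++ xs ys f)) (≈-sym (assoc _ _ _))

  Σ-cong : ∀ {A : Set} (xs : List A) {f g} → (∀ {x} → x ∈ xs → f x ≈ g x) → ∑[ xs ] f ≈ ∑[ xs ] g
  Σ-cong []       f≈g = ≈-refl
  Σ-cong (x ∷ xs) f≈g = ⊕-cong (f≈g (here refl)) (Σ-cong xs (f≈g ∘ there))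

  module _ {A : Set} (_≟_ : DecidableEquality A) where
    open DecMembership _≟_ using (_∈?_)

    -- Turns a membership test into a sum of equality tests, which can then be exchanged with other
    -- sums. A repeated entry would be counted twice on the right, hence `Unique`.
    Σ-when : ∀ {xs} → Unique xs → ∀ x c →
             when (does (x ∈? xs)) c ≈ ∑[ xs ] λ y → when (does (x ≟ y)) c
    Σ-when []                   x c = ≈-refl
    Σ-when {y ∷ xs} (y∉ ∷ uniq) x c with x ≟ y
    ... | no _ = ≈-trans (Σ-when uniq x c) (≈-sym (identityˡ _))
    ... | yes refl = ≈-sym (≈-trans (⊕-congˡ (≈-trans (≈-sym (Σ-when uniq x c)) absent)) (identityʳ c))
      where
      absent : when (does (x ∈? xs)) c ≈ ε
      absent rewrite dec-false (x ∈? xs) (λ x∈xs → All.lookup y∉ x∈xs refl) = ≈-refl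

module ℕΣ = ListSum ℕ.+-0-commutativeMonoid
open ListSum ℚ.+-0-commutativeMonoid

-- Weights of points and degrees of families.

ι : Sign → ℕ
ι Sign.- = 0
ι Sign.+ = 1

weight : ∀ {n} → Cube n → ℕ
weight x = sum (λ i → ι (lookup x i))

degree : ∀ {n} → List (Cube n) → Fin n → ℕ
degree L i = ℕΣ.∑[ L ] λ A → ι (lookup A i)

weight-neg : ∀ {n} (x : Cube n) → weight x ℕ.+ weight (neg x) ≡ n
weight-neg []           = refl
weight-neg (Sign.+ ∷ x) = cong suc (weight-neg x)
weight-neg (Sign.- ∷ x) = trans (ℕ.+-suc _ _) (cong suc (weight-neg x))

neg-involutive : ∀ {n} (x : Cube n) → neg (neg x) ≡ x
neg-involutive []      = refl
neg-involutive (s ∷ x) = cong₂ _∷_ (Sign.opposite-selfInverse refl) (neg-involutive x)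

-- Going up in the coordinatewise order without moving strictly increases the weight. Monotonicity
-- thereby becomes mostly a comparison of weights.
weight-mono : ∀ {n} {x y : Cube n} → x ≥ᶜ y → x ≡ y ⊎ weight y < weight x
weight-mono {x = []}         {[]}         x≥y = inj₁ refl
weight-mono {x = s ∷ x}      {t ∷ y}      x≥y with weight-mono (Pointwise.tail x≥y)
weight-mono {x = Sign.+ ∷ x} {Sign.+ ∷ y} x≥y | inj₁ refl = inj₁ refl
weight-mono {x = Sign.+ ∷ x} {Sign.- ∷ y} x≥y | inj₁ refl = inj₂ ℕ.≤-refl
weight-mono {x = Sign.- ∷ x} {Sign.- ∷ y} x≥y | inj₁ refl = inj₁ refl
weight-mono {x = Sign.+ ∷ x} {Sign.+ ∷ y} x≥y | inj₂ y<x = inj₂ (s≤s y<x)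
weight-mono {x = Sign.+ ∷ x} {Sign.- ∷ y} x≥y | inj₂ y<x = inj₂ (ℕ.m<n⇒m<1+n y<x)
weight-mono {x = Sign.- ∷ x} {Sign.- ∷ y} x≥y | inj₂ y<x = inj₂ y<x
weight-mono {x = Sign.- ∷ x} {Sign.+ ∷ y} x≥y | _ with Pointwise.head x≥y
... | ()

weight-flip : ∀ {n} (x : Cube n) i →
  (lookup x i ≡ Sign.+ → suc (weight (x ^⊕ i)) ≡ weight x) ×
  (lookup x i ≡ Sign.- → weight (x ^⊕ i) ≡ suc (weight x))
weight-flip (s ∷ x)      (suc i) with weight-flip x i
... | down , up = (λ e → trans (sym (ℕ.+-suc (ι s) _)) (cong (ι s ℕ.+_) (down e)))
                , (λ e → trans (cong (ι s ℕ.+_) (up e)) (ℕ.+-suc (ι s) _))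
weight-flip (Sign.+ ∷ x) zero    = (λ _ → refl) , λ ()
weight-flip (Sign.- ∷ x) zero    = (λ ()) , (λ _ → refl)

-- Rational sums over the cube.

Σᶜ : ∀ {n} → (Cube n → ℚ) → ℚ
Σᶜ {zero}  f = f []
Σᶜ {suc n} f = Σᶜ (λ x → f (Sign.- ∷ x)) ℚ.+ Σᶜ (λ x → f (Sign.+ ∷ x))

Σᶜ-cong : ∀ {n} {f g : Cube n → ℚ} → (∀ x → f x ≡ g x) → Σᶜ f ≡ Σᶜ g
Σᶜ-cong {zero}  f≡g = f≡g []
Σᶜ-cong {suc n} f≡g = cong₂ ℚ._+_ (Σᶜ-cong (λ x → f≡g (Sign.- ∷ x))) (Σᶜ-cong (λ x → f≡g (Sign.+ ∷ x)))

private
  interchange : ∀ a b c d → (a ℚ.+ b) ℚ.+ (c ℚ.+ d) ≡ (a ℚ.+ c) ℚ.+ (b ℚ.+ d)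
  interchange = solve 4 (λ a b c d → (a :+ b) :+ (c :+ d) := (a :+ c) :+ (b :+ d)) refl
    where open ℚ.+-*-Solver

Σᶜ-+ : ∀ {n} (f g : Cube n → ℚ) → Σᶜ (λ x → f x ℚ.+ g x) ≡ Σᶜ f ℚ.+ Σᶜ g
Σᶜ-+ {zero}  f g = refl
Σᶜ-+ {suc n} f g = trans (cong₂ ℚ._+_ (Σᶜ-+ (λ x → f (Sign.- ∷ x)) _) (Σᶜ-+ (λ x → f (Sign.+ ∷ x)) _))
  (interchange (Σᶜ {n} (λ x → f (Sign.- ∷ x))) _ _ _)

Σᶜ-0 : ∀ n → Σᶜ {n} (λ _ → 0ℚ) ≡ 0ℚ
Σᶜ-0 zero    = refl
Σᶜ-0 (suc n) = cong₂ ℚ._+_ (Σᶜ-0 n) (Σᶜ-0 n)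

Σᶜ-flip : ∀ {n} (f : Cube n → ℚ) i → Σᶜ (λ x → f (x ^⊕ i)) ≡ Σᶜ f
Σᶜ-flip {suc n} f zero    = ℚ.+-comm (Σᶜ (λ x → f (Sign.+ ∷ x))) (Σᶜ (λ x → f (Sign.- ∷ x)))
Σᶜ-flip {suc n} f (suc i) = cong₂ ℚ._+_ (Σᶜ-flip (λ x → f (Sign.- ∷ x)) i) (Σᶜ-flip (λ x → f (Sign.+ ∷ x)) i)

Σᶜ-neg : ∀ {n} (f : Cube n → ℚ) → Σᶜ (f ∘ neg) ≡ Σᶜ f
Σᶜ-neg {zero}  f = refl
Σᶜ-neg {suc n} f = trans (cong₂ ℚ._+_ (Σᶜ-neg (λ x → f (Sign.+ ∷ x))) (Σᶜ-neg (λ x → f (Sign.- ∷ x))))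
                         (ℚ.+-comm (Σᶜ (λ x → f (Sign.+ ∷ x))) _)

_≟ᶜ_ : ∀ {n} → DecidableEquality (Cube n)
_≟ᶜ_ = Vec.≡-dec Sign._≟_

Σᶜ-point : ∀ {n} (A : Cube n) (f : Cube n → ℚ) → Σᶜ (λ x → when (does (x ≟ᶜ A)) (f x)) ≡ f A
Σᶜ-point []           f = refl
Σᶜ-point {suc n} (Sign.+ ∷ A) f =
  trans (cong₂ ℚ._+_ (Σᶜ-0 n) (Σᶜ-point A (λ x → f (Sign.+ ∷ x)))) (ℚ.+-identityˡ _)
Σᶜ-point {suc n} (Sign.- ∷ A) f =
  trans (cong₂ ℚ._+_ (Σᶜ-point A (λ x → f (Sign.- ∷ x))) (Σᶜ-0 n)) (ℚ.+-identityʳ _)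

module _ {n : ℕ} where
  open DecMembership (_≟ᶜ_ {n}) using (_∈?_) public

Σᶜ-Σ : ∀ {n} {A : Set} (L : List A) (f : A → Cube n → ℚ) →
       Σᶜ (λ x → ∑[ L ] λ a → f a x) ≡ ∑[ L ] λ a → Σᶜ (f a)
Σᶜ-Σ {n} []      f = Σᶜ-0 n
Σᶜ-Σ     (a ∷ L) f = trans (Σᶜ-+ (f a) _) (cong (Σᶜ (f a) ℚ.+_) (Σᶜ-Σ L f))

-- The membership test is expanded over `L`; after exchanging the two sums each inner one has a
-- single nonzero point.
Σᶜ-∈ : ∀ {n} {L : List (Cube n)} → Unique L → ∀ f →
       Σᶜ (λ x → when (does (x ∈? L)) (f x)) ≡ ∑[ L ] f
Σᶜ-∈ {L = L} uniq f =
  trans (Σᶜ-cong (λ x → Σ-when _≟ᶜ_ uniq x (f x)))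
  (trans (Σᶜ-Σ L (λ A x → when (does (x ≟ᶜ A)) (f x)))
         (Σ-cong L (λ {A} _ → Σᶜ-point A f)))

-- The weight is symmetric in the coordinates. By induction the observed coordinate moves to the
-- second place; `interchange` then swaps the mixed terms `(-,+)` and `(+,-)`, which exchanges the
-- first two places.
Σᶜ-weight-lookup₀ : ∀ {n} (h : ℕ → Sign → ℚ) (i : Fin (suc n)) →
  Σᶜ (λ x → h (weight x) (lookup x i)) ≡ Σᶜ {suc n} (λ x → h (weight x) (lookup x zero))
Σᶜ-weight-lookup₀         h zero    = refl
Σᶜ-weight-lookup₀ {suc n} h (suc i) =
  trans (cong₂ ℚ._+_ (Σᶜ-weight-lookup₀ h i) (Σᶜ-weight-lookup₀ (h ∘ suc) i))
        (interchange (Σᶜ {n} (λ x → h (weight x) Sign.-)) (Σᶜ {n} (λ x → h (suc (weight x)) Sign.+)) _ _)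

Σᶜ-weight-lookup : ∀ {n} (h : ℕ → Sign → ℚ) (i j : Fin n) →
  Σᶜ (λ x → h (weight x) (lookup x i)) ≡ Σᶜ (λ x → h (weight x) (lookup x j))
Σᶜ-weight-lookup {suc n} h i j = trans (Σᶜ-weight-lookup₀ h i) (sym (Σᶜ-weight-lookup₀ h j))

-- Every function on two signs is affine: `h s` is `h -` plus `ι s` times `h + - h -`. So the sum
-- over `L` depends only on the length of `L` and on how often `s` is `+`; for coordinates of
-- members this count is the degree.
Σ-affine : ∀ {A : Set} (L : List A) (s : A → Sign) (h : Sign → ℚ) →
  ∑[ L ] (h ∘ s) ≡ length L · h Sign.- ℚ.+ ℕΣ.∑[ L ] (ι ∘ s) · (h Sign.+ ℚ.- h Sign.-)
Σ-affine []      s h = refl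
Σ-affine (a ∷ L) s h with s a
... | Sign.- = trans (cong (h Sign.- ℚ.+_) (Σ-affine L s h)) (sym (ℚ.+-assoc (h Sign.-) _ _))
... | Sign.+ = trans (cong (h Sign.+ ℚ.+_) (Σ-affine L s h)) (rearrange (h Sign.+) (h Sign.-) _ _)
  where
  open ℚ.+-*-Solver
  rearrange : ∀ p q u v → p ℚ.+ (u ℚ.+ v) ≡ (q ℚ.+ u) ℚ.+ ((p ℚ.- q) ℚ.+ v)
  rearrange = solve 4 (λ p q u v → p :+ (u :+ v) := (q :+ u) :+ ((p :- q) :+ v)) refl

Σ-regular : ∀ {A : Set} (L : List A) (s t : A → Sign) (h : Sign → ℚ) →
  ℕΣ.∑[ L ] (ι ∘ s) ≡ ℕΣ.∑[ L ] (ι ∘ t) → ∑[ L ] (h ∘ s) ≡ ∑[ L ] (h ∘ t)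
Σ-regular L s t h eq =
  trans (Σ-affine L s h) (trans (cong (λ d → length L · h Sign.- ℚ.+ d · _) eq) (sym (Σ-affine L t h)))

-- Influences of monotone rules

-- Links the enumeration that defines `ℙ` to the recursive sum `Σᶜ`, which suits induction on
-- coordinates.
Σ-cube : ∀ {n} (f : Cube n → ℚ) → ∑[ cube n ] f ≡ Σᶜ f
Σ-cube {zero}  f = ℚ.+-identityʳ (f [])
Σ-cube {suc n} f = trans (Σ-++ (half Sign.-) _ f) (cong₂ ℚ._+_ (Σ-half Sign.-)
  (trans (Σ-++ (half Sign.+) [] f) (trans (ℚ.+-identityʳ _) (Σ-half Sign.+))))
  where
  half = λ s → List.map (s ∷_) (cube n)
  Σ-map : ∀ {A B : Set} (g : A → B) xs (h : B → ℚ) → ∑[ List.map g xs ] h ≡ ∑[ xs ] (h ∘ g)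
  Σ-map g []       h = refl
  Σ-map g (x ∷ xs) h = cong (h (g x) ℚ.+_) (Σ-map g xs h)
  Σ-half : ∀ s → ∑[ half s ] f ≡ Σᶜ (λ x → f (s ∷ x))
  Σ-half s = trans (Σ-map (s ∷_) (cube n) f) (Σ-cube (λ x → f (s ∷ x)))

seq-filter-sum : ∀ {A : Set} {E : Pred A 0ℓ} (E? : Decidable E) (q : A → ℝ) xs t →
  seq (sumᴿ (List.map q (filter E? xs))) t ≡ ∑[ xs ] λ x → when (does (E? x)) (seq (q x) t)
seq-filter-sum E? q []       t = refl
seq-filter-sum E? q (x ∷ xs) t with does (E? x)
... | true  = cong (seq (q x) t ℚ.+_) (seq-filter-sum E? q xs t)
... | false = trans (seq-filter-sum E? q xs t) (sym (ℚ.+-identityˡ _))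

-- The weight of `neg x` is `n` minus that of `x`, so at each index `t` the approximate mass of a
-- point is a function of its weight alone.
seq-product : ∀ (p : ProbabilityMeasure signs) t {n} (x : Cube n) →
  seq ((p ^⊗ n) x) t ≡ seq (mass p Sign.+) t ^ weight x ℚ.* seq (mass p Sign.-) t ^ weight (neg x)
seq-product p t []           = refl
seq-product p t (Sign.+ ∷ x) =
  trans (cong (b ℚ.*_) (seq-product p t x)) (sym (ℚ.*-assoc b _ _))
  where b = seq (mass p Sign.+) t
seq-product p t (Sign.- ∷ x) =
  trans (cong (a ℚ.*_) (seq-product p t x)) (rearrange a (b ^ weight x) _)
  where
  a = seq (mass p Sign.-) t
  b = seq (mass p Sign.+) t
  rearrange : ∀ a u v → a ℚ.* (u ℚ.* v) ≡ u ℚ.* (a ℚ.* v)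
  rearrange = solve 3 (λ a u v → a :* (u :* v) := u :* (a :* v)) refl
    where open ℚ.+-*-Solver

weight-neg-∸ : ∀ {n} (x : Cube n) → weight (neg x) ≡ n ∸ weight x
weight-neg-∸ x = trans (sym (ℕ.m+n∸m≡n (weight x) _)) (cong (_∸ weight x) (weight-neg x))

≥ˢ-+ : ∀ s → Sign.+ ≥ˢ s
≥ˢ-+ Sign.+ = +≤+ (s≤s z≤n)
≥ˢ-+ Sign.- = -≤+

≥ˢ-- : ∀ s → s ≥ˢ Sign.-
≥ˢ-- Sign.+ = -≤+
≥ˢ-- Sign.- = -≤- z≤n

≥ˢ-refl : ∀ {s} → s ≥ˢ s
≥ˢ-refl {Sign.+} = ≥ˢ-+ Sign.+
≥ˢ-refl {Sign.-} = ≥ˢ-- Sign.-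

≥ˢ-upward : ∀ {s t} → s ≥ˢ t → t ≡ Sign.+ → s ≡ Sign.+
≥ˢ-upward {Sign.+} s≥t refl = refl
≥ˢ-upward {Sign.-} ()  refl

flip-≤ : ∀ {n} (x : Cube n) i → lookup x i ≡ Sign.+ → x ≥ᶜ (x ^⊕ i)
flip-≤ (s ∷ x) zero    refl = ext λ { zero → ≥ˢ-+ Sign.- ; (suc j) → ≥ˢ-refl }
flip-≤ (s ∷ x) (suc i) e    = ext λ { zero → ≥ˢ-refl ; (suc j) → Pointwise.app (flip-≤ x i e) j }

flip-≥ : ∀ {n} (x : Cube n) i → lookup x i ≡ Sign.- → (x ^⊕ i) ≥ᶜ x
flip-≥ (s ∷ x) zero    refl = ext λ { zero → ≥ˢ-+ Sign.- ; (suc j) → ≥ˢ-refl }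
flip-≥ (s ∷ x) (suc i) e    = ext λ { zero → ≥ˢ-refl ; (suc j) → Pointwise.app (flip-≥ x i e) j }

flip-involutive : ∀ {n} (x : Cube n) i → (x ^⊕ i) ^⊕ i ≡ x
flip-involutive (s ∷ x) zero    = cong (_∷ x) (Sign.opposite-selfInverse refl)
flip-involutive (s ∷ x) (suc i) = cong (s ∷_) (flip-involutive x i)

on : Sign → ℚ → ℚ
on Sign.+ c = c
on Sign.- c = 0ℚ

signed : Sign → ℚ → ℚ
signed Sign.+ c = c
signed Sign.- c = ℚ.- c

-- With `s` the sign of voter i at x, `t` the outcome at x and `u` the outcome after the flip,
-- monotonicity fixes the direction of any change, so the indicator of `t ≠ u` is `s` times the
-- difference of the indicators of `t = +` and `u = +`.
pivotal-split : ∀ s t u w → (s ≡ Sign.+ → t ≥ˢ u) → (s ≡ Sign.- → u ≥ˢ t) →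
  when (does (¬? (t Sign.≟ u))) w ≡ signed s (on t w) ℚ.+ signed (opposite s) (on u w)
pivotal-split Sign.+ Sign.+ Sign.+ w t≥u u≥t = sym (ℚ.+-inverseʳ w)
pivotal-split Sign.+ Sign.+ Sign.- w t≥u u≥t = sym (ℚ.+-identityʳ w)
pivotal-split Sign.+ Sign.- Sign.+ w t≥u u≥t with t≥u refl
... | ()
pivotal-split Sign.+ Sign.- Sign.- w t≥u u≥t = refl
pivotal-split Sign.- Sign.+ Sign.+ w t≥u u≥t = sym (ℚ.+-inverseˡ w)
pivotal-split Sign.- Sign.+ Sign.- w t≥u u≥t with u≥t refl
... | ()
pivotal-split Sign.- Sign.- Sign.+ w t≥u u≥t = sym (ℚ.+-identityˡ w)
pivotal-split Sign.- Sign.- Sign.- w t≥u u≥t = refl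

module _ (pw : ℕ → ℚ) where

  -- With pw k the mass of a point of weight k, this is the coefficient of [Φ x = +] in the
  -- influence of i, in terms of weight x and xᵢ.  A point with xᵢ = + has positive weight,
  -- so the junk value pred 0 plays no role.
  kernel : ℕ → Sign → ℚ
  kernel k Sign.+ = pw k ℚ.+ pw (pred k)
  kernel k Sign.- = ℚ.- (pw k ℚ.+ pw (suc k))

  kernel-split : ∀ {n} (x : Cube n) i t →
    signed (lookup x i) (on t (pw (weight x))) ℚ.+ signed (lookup x i) (on t (pw (weight (x ^⊕ i))))
    ≡ on t (kernel (weight x) (lookup x i))
  kernel-split x i t with lookup x i | weight-flip x i
  kernel-split x i Sign.+ | Sign.+ | down , _ =
    cong (λ k → pw (weight x) ℚ.+ pw k) (cong pred (down refl))
  kernel-split x i Sign.- | Sign.+ | _        = refl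
  kernel-split x i Sign.+ | Sign.- | _ , up   =
    trans (cong (λ k → ℚ.- pw (weight x) ℚ.+ ℚ.- pw k) (up refl)) (sym (ℚ.neg-distrib-+ (pw (weight x)) _))
  kernel-split x i Sign.- | Sign.- | _        = refl

  -- `pivotal-split` yields one term in `Φ x` and one in `Φ (x ^⊕ i)`. Reindexing the second by the
  -- flip, a bijection of the cube, makes both refer to `Φ x`, and their coefficients add up to
  -- `kernel`.
  pivotal-sum : ∀ {n} {Φ : VotingRule n} → Monotone Φ → ∀ i →
    Σᶜ (λ x → when (does (¬? (Φ x Sign.≟ Φ (x ^⊕ i)))) (pw (weight x)))
    ≡ Σᶜ (λ x → on (Φ x) (kernel (weight x) (lookup x i)))
  pivotal-sum {Φ = Φ} mono i =
    trans (Σᶜ-cong split)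
    (trans (Σᶜ-+ f (λ x → g (x ^⊕ i)))
    (trans (cong (Σᶜ f ℚ.+_) (Σᶜ-flip g i))
    (trans (sym (Σᶜ-+ f g)) (Σᶜ-cong λ x → kernel-split x i (Φ x)))))
    where
    f g : Cube _ → ℚ
    f x = signed (lookup x i) (on (Φ x) (pw (weight x)))
    g x = signed (lookup x i) (on (Φ x) (pw (weight (x ^⊕ i))))

    split : ∀ x → when (does (¬? (Φ x Sign.≟ Φ (x ^⊕ i)))) (pw (weight x)) ≡ f x ℚ.+ g (x ^⊕ i)
    split x = trans (pivotal-split (lookup x i) (Φ x) (Φ (x ^⊕ i)) (pw (weight x))
      (λ e → mono _ _ (flip-≤ x i e))
      (λ e → mono _ _ (flip-≥ x i e)))
      (cong (f x ℚ.+_) (sym (cong₂ (λ s y → signed s (on (Φ (x ^⊕ i)) (pw (weight y))))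
        (Vec.lookup∘updateAt i x) (flip-involutive x i))))

-- An influence is a polynomial in the masses of the two signs, and the hypothesis is applied with
-- `h` the kernel built from their rational approximations at a given index.
unbiased-criterion : ∀ {n} {Φ : VotingRule n} → Monotone Φ →
  (∀ (h : ℕ → Sign → ℚ) i j → Σᶜ (λ x → on (Φ x) (h (weight x) (lookup x i)))
                            ≡ Σᶜ (λ x → on (Φ x) (h (weight x) (lookup x j)))) →
  Unbiased Φ
-- The two approximating sequences agree at every index, so the bound may start from index 0.
unbiased-criterion {n} {Φ} mono indep p i j ε 0<ε = 0 , λ t _ →
  subst (λ d → ∣ d ∣ ℚ.≤ ε) (sym (difference t)) (ℚ.<⇒≤ 0<ε)
  where
  pw : ℕ → ℕ → ℚ
  pw t k = seq (mass p Sign.+) t ^ k ℚ.* seq (mass p Sign.-) t ^ (n ∸ k)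

  seq-influence : ∀ t i → seq (influence (p ^⊗ n) Φ i) t
                        ≡ Σᶜ (λ x → on (Φ x) (kernel (pw t) (weight x) (lookup x i)))
  seq-influence t i =
    trans (seq-filter-sum (λ x → ¬? (Φ x Sign.≟ Φ (x ^⊕ i))) (p ^⊗ n) (cube n) t)
    (trans (Σ-cube (λ x → when (does (¬? (Φ x Sign.≟ Φ (x ^⊕ i)))) (seq ((p ^⊗ n) x) t)))
    (trans (Σᶜ-cong λ x → cong (when (does (¬? (Φ x Sign.≟ Φ (x ^⊕ i)))))
             (trans (seq-product p t x)
               (cong (λ k → seq (mass p Sign.+) t ^ weight x ℚ.* seq (mass p Sign.-) t ^ k) (weight-neg-∸ x))))
           (pivotal-sum (pw t) mono i)))

  difference : ∀ t → seq (influence (p ^⊗ n) Φ i) t ℚ.- seq (influence (p ^⊗ n) Φ j) t ≡ 0ℚ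
  difference t = trans (cong (ℚ._- seq (influence (p ^⊗ n) Φ j) t)
    (trans (seq-influence t i) (trans (indep (kernel (pw t)) i j) (sym (seq-influence t j)))))
    (ℚ.+-inverseʳ (seq (influence (p ^⊗ n) Φ j) t))

-- Majority perturbed by an intersecting family

module Perturbation {m n} (n≡1+2m : n ≡ suc (m ℕ.+ m)) (L : List (Cube n)) (unique : Unique L)
  (size : ∀ {A} → A ∈ L → weight A ≡ m)
  (meet : ∀ {A B} → A ∈ L → B ∈ L → ∃[ i ] (lookup A i ≡ Sign.+ × lookup B i ≡ Sign.+)) where

  -- The rule is given as a relation with evidence for each case, so that oddness and monotonicity
  -- are proved by cases on evidence; `outcome` and `outcome-unique` show that it is the graph of a
  -- function.
  data Outcome (x : Cube n) : Sign → Set where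
    member  : x ∈ L → Outcome x Sign.+
    opposed : neg x ∈ L → Outcome x Sign.-
    small   : x ∉ L → neg x ∉ L → weight x ≤ m → Outcome x Sign.-
    large   : x ∉ L → neg x ∉ L → m < weight x → Outcome x Sign.+

  outcome : ∀ x → ∃[ s ] Outcome x s
  outcome x with x ∈? L | neg x ∈? L | weight x ℕ.≤? m
  ... | yes x∈L | _         | _     = _ , member x∈L
  ... | no x∉L  | yes -x∈L  | _     = _ , opposed -x∈L
  ... | no x∉L  | no -x∉L   | yes ≤m = _ , small x∉L -x∉L ≤m
  ... | no x∉L  | no -x∉L   | no ≰m = _ , large x∉L -x∉L (ℕ.≰⇒> ≰m)

  Φ : VotingRule n
  Φ x = proj₁ (outcome x)

  weights-total : ∀ x → weight x ℕ.+ weight (neg x) ≡ suc (m ℕ.+ m)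
  weights-total x = trans (weight-neg x) n≡1+2m

  weight-co : ∀ {x} → neg x ∈ L → weight x ≡ suc m
  weight-co {x} -x∈L = ℕ.+-cancelʳ-≡ m (weight x) (suc m)
    (trans (cong (weight x ℕ.+_) (sym (size -x∈L))) (weights-total x))

  disjoint : ∀ {x} → x ∈ L → neg x ∈ L → ⊥
  disjoint x∈L -x∈L = ℕ.1+n≢n (trans (sym (weight-co -x∈L)) (size x∈L))

  outcome-unique : ∀ {x s t} → Outcome x s → Outcome x t → s ≡ t
  outcome-unique (member _)      (member _)      = refl
  outcome-unique (member x∈L)    (opposed -x∈L)  = contradiction -x∈L (disjoint x∈L)
  outcome-unique (member x∈L)    (small x∉L _ _) = contradiction x∈L x∉L
  outcome-unique (member _)      (large _ _ _)   = refl
  outcome-unique (opposed -x∈L)  (member x∈L)    = contradiction -x∈L (disjoint x∈L)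
  outcome-unique (opposed _)     (opposed _)     = refl
  outcome-unique (opposed _)     (small _ _ _)   = refl
  outcome-unique (opposed -x∈L)  (large _ -x∉L _) = contradiction -x∈L -x∉L
  outcome-unique (small x∉L _ _) (member x∈L)    = contradiction x∈L x∉L
  outcome-unique (small _ _ _)   (opposed _)     = refl
  outcome-unique (small _ _ _)   (small _ _ _)   = refl
  outcome-unique (small _ _ ≤m)  (large _ _ >m)  = contradiction ≤m (ℕ.<⇒≱ >m)
  outcome-unique (large _ _ _)   (member _)      = refl
  outcome-unique (large _ -x∉L _) (opposed -x∈L) = contradiction -x∈L -x∉L
  outcome-unique (large _ _ >m)  (small _ _ ≤m)  = contradiction ≤m (ℕ.<⇒≱ >m)
  outcome-unique (large _ _ _)   (large _ _ _)   = refl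

  weight-neg-> : ∀ {x} → weight x ≤ m → m < weight (neg x)
  weight-neg-> {x} ≤m = ℕ.+-cancelˡ-≤ m _ _
    (subst (_≤ m ℕ.+ weight (neg x)) (trans (weights-total x) (sym (ℕ.+-suc m m)))
      (ℕ.+-monoˡ-≤ (weight (neg x)) ≤m))

  weight-neg-≤ : ∀ {x} → m < weight x → weight (neg x) ≤ m
  weight-neg-≤ {x} >m = ℕ.+-cancelˡ-≤ (suc m) _ _
    (subst (suc m ℕ.+ weight (neg x) ≤_) (weights-total x) (ℕ.+-monoˡ-≤ (weight (neg x)) >m))

  -- Negation exchanges `member` with `opposed` and `small` with `large`; as `n` is odd, exactly one
  -- of `x` and `neg x` has weight at most `m`.
  outcome-neg : ∀ {x s} → Outcome x s → Outcome (neg x) (opposite s)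
  outcome-neg {x} (member x∈L)   = opposed (subst (_∈ L) (sym (neg-involutive x)) x∈L)
  outcome-neg     (opposed -x∈L) = member -x∈L
  outcome-neg {x} (small x∉L -x∉L ≤m) =
    large -x∉L (x∉L ∘ subst (_∈ L) (neg-involutive x)) (weight-neg-> {x} ≤m)
  outcome-neg {x} (large x∉L -x∉L >m) =
    small -x∉L (x∉L ∘ subst (_∈ L) (neg-involutive x)) (weight-neg-≤ {x} >m)

  odd : Odd Φ
  odd x = outcome-unique (proj₂ (outcome (neg x))) (outcome-neg (proj₂ (outcome x)))

  -- For distinct points the weights refute every case but `member` against `opposed`. There `y` and
  -- `neg x` both lie in `L`, and at a common voter `y` has `+` while `x` has `-`, against `x ≥ᶜ y`.
  outcome-monotone : ∀ {x y} → x ≥ᶜ y → Outcome y Sign.+ → Outcome x Sign.- → ⊥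
  outcome-monotone x≥y y⁺ x⁻ with weight-mono x≥y
  ... | inj₁ refl with outcome-unique x⁻ y⁺
  ...   | ()
  outcome-monotone {x} x≥y (member y∈L) (opposed -x∈L) | inj₂ _ with meet y∈L -x∈L
  ... | i , yᵢ≡+ , -xᵢ≡+ = contradiction
    (trans (sym -xᵢ≡+) (trans (Vec.lookup-map i opposite x)
      (cong opposite (≥ˢ-upward (Pointwise.app x≥y i) yᵢ≡+))))
    λ ()
  outcome-monotone x≥y (member y∈L) (small _ _ x≤m) | inj₂ y<x =
    ℕ.<⇒≱ (subst (_< _) (size y∈L) y<x) x≤m
  outcome-monotone x≥y (large _ _ m<y) (opposed -x∈L) | inj₂ y<x =
    ℕ.<-irrefl refl (ℕ.<-≤-trans m<y (ℕ.s≤s⁻¹ (subst (_ <_) (weight-co -x∈L) y<x)))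
  outcome-monotone x≥y (large _ _ m<y) (small _ _ x≤m) | inj₂ y<x =
    ℕ.<⇒≱ (ℕ.<-trans m<y y<x) x≤m

  monotone : Monotone Φ
  monotone x y x≥y with outcome x | outcome y
  ... | Sign.+ , _  | s      , _  = ≥ˢ-+ s
  ... | Sign.- , _  | Sign.- , _  = ≥ˢ-- Sign.-
  ... | Sign.- , x⁻ | Sign.+ , y⁺ = contradiction x⁻ (outcome-monotone x≥y y⁺)

  majority : ℕ → Sign
  majority k = if does (k ℕ.≤? m) then Sign.- else Sign.+

  majority-≤ : ∀ {k} → k ≤ m → majority k ≡ Sign.-
  majority-≤ {k} k≤m rewrite dec-true (k ℕ.≤? m) k≤m = refl

  majority-> : ∀ {k} → m < k → majority k ≡ Sign.+
  majority-> {k} m<k rewrite dec-false (k ℕ.≤? m) (ℕ.<⇒≱ m<k) = refl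

  -- The winning points are those of majority, with the members of `L` added and their complements
  -- removed. The removal stands on the left as an addition.
  outcome-split : ∀ {x s} → Outcome x s → ∀ c →
    on s c ℚ.+ when (does (neg x ∈? L)) c ≡ on (majority (weight x)) c ℚ.+ when (does (x ∈? L)) c
  outcome-split {x} (member x∈L) c
    rewrite dec-true (x ∈? L) x∈L | dec-false (neg x ∈? L) (disjoint x∈L)
          | majority-≤ (ℕ.≤-reflexive (size x∈L)) = ℚ.+-comm c 0ℚ
  outcome-split {x} (opposed -x∈L) c
    rewrite dec-true (neg x ∈? L) -x∈L | dec-false (x ∈? L) (λ x∈L → disjoint x∈L -x∈L)
          | majority-> (ℕ.≤-reflexive (sym (weight-co -x∈L))) = ℚ.+-comm 0ℚ c
  outcome-split {x} (small x∉L -x∉L ≤m) c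
    rewrite dec-false (neg x ∈? L) -x∉L | dec-false (x ∈? L) x∉L | majority-≤ ≤m = refl
  outcome-split {x} (large x∉L -x∉L >m) c
    rewrite dec-false (neg x ∈? L) -x∉L | dec-false (x ∈? L) x∉L | majority-> >m = refl

  module _ (regular : ∀ i j → degree L i ≡ degree L j) where

    -- The majority part is symmetric in the voters; the two corrections are sums over `L` of a
    -- function of one coordinate, and these agree for all voters by regularity.
    unbiased : Unbiased Φ
    unbiased = unbiased-criterion monotone independent
      where
      module _ (h : ℕ → Sign → ℚ) where
        winning losing ordinary : Fin n → ℚ
        winning  i = ∑[ L ] λ A → h m (lookup A i)
        losing   i = ∑[ L ] λ A → h (suc m) (opposite (lookup A i))
        ordinary i = Σᶜ {n} λ x → on (majority (weight x)) (h (weight x) (lookup x i))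

        H : Fin n → Cube n → ℚ
        H i x = h (weight x) (lookup x i)

        Σ-winning : ∀ i → Σᶜ (λ x → when (does (x ∈? L)) (H i x)) ≡ winning i
        Σ-winning i = trans (Σᶜ-∈ unique (H i))
          (Σ-cong L λ {A} A∈L → cong (λ k → h k (lookup A i)) (size A∈L))

        Σ-losing : ∀ i → Σᶜ (λ x → when (does (neg x ∈? L)) (H i x)) ≡ losing i
        Σ-losing i =
          -- Writing `x` as `neg (neg x)` makes the summand a function of `neg x`, ready for
          -- reindexing by negation.
          trans (Σᶜ-cong λ x → cong (λ y → when (does (neg x ∈? L)) (H i y)) (sym (neg-involutive x)))
          (trans (Σᶜ-neg (λ x → when (does (x ∈? L)) (H i (neg x))))
          (trans (Σᶜ-∈ unique (H i ∘ neg))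
                 (Σ-cong L λ {A} A∈L → cong₂ h
                   (weight-co (subst (_∈ L) (sym (neg-involutive A)) A∈L))
                   (Vec.lookup-map i opposite A))))

        balance : ∀ i → Σᶜ (λ x → on (Φ x) (H i x)) ℚ.+ losing i ≡ ordinary i ℚ.+ winning i
        balance i =
          trans (cong (Σᶜ (λ x → on (Φ x) (H i x)) ℚ.+_) (sym (Σ-losing i)))
          (trans (sym (Σᶜ-+ (λ x → on (Φ x) (H i x)) _))
          (trans (Σᶜ-cong λ x → outcome-split (proj₂ (outcome x)) (H i x))
          (trans (Σᶜ-+ (λ x → on (majority (weight x)) (H i x)) _)
                 (cong (ordinary i ℚ.+_) (Σ-winning i)))))

        independent : ∀ i j → Σᶜ (λ x → on (Φ x) (H i x)) ≡ Σᶜ (λ x → on (Φ x) (H j x))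
        -- After `losing j` is added to both sides, regularity replaces it by `losing i` on the
        -- left, so that `balance` applies to each side.
        independent i j = ∙-cancelʳ (losing j) _ _
          (trans (cong (Σᶜ (λ x → on (Φ x) (H i x)) ℚ.+_)
                   (Σ-regular L (λ A → lookup A j) (λ A → lookup A i) (h (suc m) ∘ opposite) (regular j i)))
          (trans (balance i)
          (trans (cong₂ ℚ._+_
                   (Σᶜ-weight-lookup (λ k s → on (majority k) (h k s)) i j)
                   (Σ-regular L (λ A → lookup A i) (λ A → lookup A j) (h m) (regular i j)))
                 (sym (balance j)))))

  weight-permute : ∀ (σ : Permutation′ n) x → weight (flip σ ∙ x) ≡ weight x
  weight-permute σ x =
    trans (sum-cong-≗ λ i → cong ι (Vec.lookup∘tabulate (λ i → lookup x (σ ⟨$⟩ʳ i)) i))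
          (sym (sum-permute (ι ∘ lookup x) σ))

  -- A winning point is a member of `L` or has weight above `m`. Permuting voters keeps the weight,
  -- so the image of a member, winning with weight `m`, is again a member.
  aut-preserves : ∀ {σ} → aut Φ σ → ∀ {A} → A ∈ L → (flip σ ∙ A) ∈ L
  aut-preserves {σ} fixes {A} A∈L = winning (subst (Outcome _)
    (trans (fixes A) (outcome-unique (proj₂ (outcome A)) (member A∈L)))
    (proj₂ (outcome (flip σ ∙ A))))
    where
    winning : Outcome (flip σ ∙ A) Sign.+ → (flip σ ∙ A) ∈ L
    winning (member ∈L)    = ∈L
    winning (large _ _ m<) = contradiction (trans (weight-permute σ A) (size A∈L)) (ℕ.>⇒≢ m<)

-- The cyclic family

Σ-tabulate : ∀ {A : Set} {n} (f : Fin n → A) g → ℕΣ.∑[ List.tabulate f ] g ≡ sum (g ∘ f)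
Σ-tabulate {n = zero}  f g = refl
Σ-tabulate {n = suc n} f g = cong (g (f zero) ℕ.+_) (Σ-tabulate (f ∘ suc) g)

sum-constant : ∀ n c → sum {n} (λ _ → c) ≡ n ℕ.* c
sum-constant zero    c = refl
sum-constant (suc n) c = cong (c ℕ.+_) (sum-constant n c)

weight-++ : ∀ {a b} (xs : Cube a) (ys : Cube b) → weight (xs Vec.++ ys) ≡ weight xs ℕ.+ weight ys
weight-++ []       ys = refl
weight-++ (s ∷ xs) ys = trans (cong (ι s ℕ.+_) (weight-++ xs ys)) (sym (ℕ.+-assoc (ι s) _ _))

weight-replicate : ∀ n s → weight (replicate n s) ≡ n ℕ.* ι s
weight-replicate n s = trans (sum-cong-≗ {n} λ i → cong ι (Vec.lookup-replicate i s)) (sum-constant n (ι s))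

weight-tabulate : ∀ {n} (f : Fin n → Sign) → weight (tabulate f) ≡ sum (ι ∘ f)
weight-tabulate f = sum-cong-≗ λ i → cong ι (Vec.lookup∘tabulate f i)

δ : ∀ {n} → Fin n → Fin n → ℕ
δ p q = if does (p Fin.≟ q) then 1 else 0

sum-δ : ∀ {n} (q : Fin n) → sum (λ p → δ p q) ≡ 1
sum-δ {suc n} zero    = cong suc (trans (sum-constant n 0) (ℕ.*-zeroʳ n))
sum-δ {suc n} (suc q) = sum-δ q

δ-comm : ∀ {n} (p q : Fin n) → δ p q ≡ δ q p
δ-comm p q with p Fin.≟ q
... | yes refl rewrite dec-true (p Fin.≟ p) refl = refl
... | no p≢q   rewrite dec-false (q Fin.≟ p) (p≢q ∘ sym) = refl

turn : ∀ {m} → Fin (suc m) → Fin (suc m)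
turn zero    = fromℕ _
turn (suc i) = inject₁ i

turn⁻¹ : ∀ {m} → Fin (suc m) → Fin (suc m)
turn⁻¹ i with view i
... | ‵fromℕ     = zero
... | ‵inject₁ j = suc j

turning : ∀ m → Permutation′ (suc m)
turning m = permutation turn turn⁻¹ turn-turn⁻¹ turn⁻¹-turn
  where
  turn-turn⁻¹ : ∀ i → turn (turn⁻¹ i) ≡ i
  turn-turn⁻¹ i with view i
  ... | ‵fromℕ     = refl
  ... | ‵inject₁ j = refl
  turn⁻¹-turn : ∀ (i : Fin (suc m)) → turn⁻¹ (turn i) ≡ i
  turn⁻¹-turn zero    rewrite view-fromℕ m = refl
  turn⁻¹-turn (suc i) rewrite view-inject₁ i = refl

module _ {m : ℕ} where

  -- τ a i is i - a modulo 1 + m.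
  τ : ℕ → Fin (suc m) → Fin (suc m)
  τ zero    i = i
  τ (suc a) i = turn (τ a i)

  -- The congruence of `τ a i` with `i - a` in subtraction-free form; `q` counts the wraps from
  -- `zero` to the top.
  toℕ-τ : ∀ a i → ∃[ q ] a ℕ.+ toℕ (τ a i) ≡ toℕ i ℕ.+ q ℕ.* suc m
  toℕ-τ zero    i = 0 , sym (ℕ.+-identityʳ _)
  toℕ-τ (suc a) i with τ a i | toℕ-τ a i
  ... | suc j | q , eq =
    q , trans (cong (λ k → suc (a ℕ.+ k)) (Fin.toℕ-inject₁ j)) (trans (sym (ℕ.+-suc a _)) eq)
  ... | zero  | q , eq = suc q , (begin
    suc (a ℕ.+ toℕ (fromℕ m))         ≡⟨ cong (λ k → suc (a ℕ.+ k)) (Fin.toℕ-fromℕ m) ⟩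
    suc (a ℕ.+ m)                     ≡⟨ rearrange a m ⟩
    (a ℕ.+ 0) ℕ.+ suc m               ≡⟨ cong (ℕ._+ suc m) eq ⟩
    toℕ i ℕ.+ q ℕ.* suc m ℕ.+ suc m   ≡⟨ ℕ.+-assoc (toℕ i) _ _ ⟩
    toℕ i ℕ.+ (q ℕ.* suc m ℕ.+ suc m) ≡⟨ cong (toℕ i ℕ.+_) (ℕ.+-comm _ (suc m)) ⟩
    toℕ i ℕ.+ suc q ℕ.* suc m         ∎)
    where
    open ≡-Reasoning
    rearrange : ∀ a m → suc (a ℕ.+ m) ≡ (a ℕ.+ 0) ℕ.+ suc m
    rearrange = solve 2 (λ a m → con 1 :+ (a :+ m) := (a :+ con 0) :+ (con 1 :+ m)) refl
      where open ℕ.+-*-Solver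

  -- A fixed point would give `a = q * suc m`, so `suc m` would divide a positive number smaller
  -- than itself.
  τ-free : ∀ a .{{_ : NonZero a}} → a < suc m → ∀ i → τ a i ≢ i
  τ-free a a<M i τi≡i with toℕ-τ a i
  ... | q , eq = ℕ.<⇒≱ a<M (∣⇒≤ (divides q (ℕ.+-cancelˡ-≡ (toℕ i) a _
    (trans (ℕ.+-comm (toℕ i) a) (trans (cong (λ j → a ℕ.+ toℕ j) (sym τi≡i)) eq)))))

  -- A rotation is a bijection, so exactly one `i` is sent to `p`. This serves to count the members
  -- through a voter, as `sum-δ` serves to count the voters of a member.
  sum-δ-τ : ∀ a p → sum (λ i → δ p (τ a i)) ≡ 1
  sum-δ-τ a p = trans (sum-τ a (δ p)) (trans (sum-cong-≗ (δ-comm p)) (sum-δ p))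
    where
    sum-τ : ∀ a f → sum (f ∘ τ a) ≡ sum f
    sum-τ zero    f = refl
    sum-τ (suc a) f = trans (sum-τ a (f ∘ turn)) (sym (sum-permute f (turning m)))

  open DecMembership (Fin._≟_ {suc m}) using () renaming (_∈?_ to _∈ᶠ?_)

  χ : List (Fin (suc m)) → Fin (suc m) → Sign
  χ ps p = if does (p ∈ᶠ? ps) then Sign.+ else Sign.-

  χ-∈ : ∀ {p ps} → p ∈ ps → χ ps p ≡ Sign.+
  χ-∈ {p} {ps} p∈ rewrite dec-true (p ∈ᶠ? ps) p∈ = refl

  χ-∉ : ∀ {p ps} → p ∉ ps → χ ps p ≡ Sign.-
  χ-∉ {p} {ps} p∉ rewrite dec-false (p ∈ᶠ? ps) p∉ = refl

  χ⁻ : ∀ {p ps} → χ ps p ≡ Sign.+ → p ∈ ps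
  χ⁻ {p} {ps} e with p ∈ᶠ? ps
  ... | yes p∈ = p∈
  ... | no  p∉ with e
  ...   | ()

  χ-δ : ∀ {ps} → Unique ps → ∀ p → ι (χ ps p) ≡ ℕΣ.∑[ ps ] (δ p)
  χ-δ {ps} uniq p = trans (ι-if (does (p ∈ᶠ? ps))) (ℕΣ.Σ-when Fin._≟_ uniq p 1)
    where
    ι-if : ∀ b → ι (if b then Sign.+ else Sign.-) ≡ (if b then 1 else 0)
    ι-if false = refl
    ι-if true  = refl

-- The family on spare, ring and outer voters.

module Construction (k : ℕ) (5≤k : 5 ≤ k) where

  m : ℕ
  m = suc (suc k)

  n : ℕ
  n = k ℕ.+ (m ℕ.+ 3)

  n≡1+2m : n ≡ suc (m ℕ.+ m)
  n≡1+2m = solve 1 (λ k → k :+ (con 2 :+ k :+ con 3) := con 1 :+ (con 2 :+ k :+ (con 2 :+ k))) refl k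
    where open ℕ.+-*-Solver

  spare : Fin k → Fin n
  spare i = i ↑ˡ (m ℕ.+ 3)

  ring : Fin m → Fin n
  ring p = k ↑ʳ (p ↑ˡ 3)

  outer : Fin 3 → Fin n
  outer u = k ↑ʳ (m ↑ʳ u)

  data Voter : Fin n → Set where
    isSpare : ∀ i → Voter (spare i)
    isRing  : ∀ p → Voter (ring p)
    isOuter : ∀ u → Voter (outer u)

  voter : ∀ v → Voter v
  voter v with splitAt k v in eq
  ... | inj₁ i = subst Voter (Fin.splitAt⁻¹-↑ˡ eq) (isSpare i)
  ... | inj₂ w with splitAt m w in eq′
  ...   | inj₁ p = subst Voter
    (trans (cong (k ↑ʳ_) (Fin.splitAt⁻¹-↑ˡ eq′)) (Fin.splitAt⁻¹-↑ʳ {k} eq)) (isRing p)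
  ...   | inj₂ u = subst Voter
    (trans (cong (k ↑ʳ_) (Fin.splitAt⁻¹-↑ʳ {m} eq′)) (Fin.splitAt⁻¹-↑ʳ {k} eq)) (isOuter u)

  blocks : Sign → (Fin m → Sign) → Sign → Cube n
  blocks s f u = replicate k s Vec.++ (tabulate f Vec.++ replicate 3 u)

  at-spare : ∀ s f u i → lookup (blocks s f u) (spare i) ≡ s
  at-spare s f u i = trans (Vec.lookup-++ˡ (replicate k s) _ i) (Vec.lookup-replicate i s)

  at-ring : ∀ s f u p → lookup (blocks s f u) (ring p) ≡ f p
  at-ring s f u p = trans (Vec.lookup-++ʳ (replicate k s) _ (p ↑ˡ 3))
    (trans (Vec.lookup-++ˡ (tabulate f) _ p) (Vec.lookup∘tabulate f p))

  at-outer : ∀ s f u i → lookup (blocks s f u) (outer i) ≡ u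
  at-outer s f u i = trans (Vec.lookup-++ʳ (replicate k s) _ (m ↑ʳ i))
    (trans (Vec.lookup-++ʳ (tabulate f) _ i) (Vec.lookup-replicate i u))

  weight-blocks : ∀ s f u → weight (blocks s f u) ≡ k ℕ.* ι s ℕ.+ (sum (ι ∘ f) ℕ.+ 3 ℕ.* ι u)
  weight-blocks s f u = trans (weight-++ (replicate k s) _) (cong₂ ℕ._+_ (weight-replicate k s)
    (trans (weight-++ (tabulate f) _) (cong₂ ℕ._+_ (weight-tabulate f) (weight-replicate 3 u))))

  edge triple : Fin m → List (Fin m)
  edge   i = i ∷ τ 1 i ∷ []
  triple j = j ∷ τ 2 j ∷ τ 4 j ∷ []

  A D : Fin m → Cube n
  A i = blocks Sign.+ (χ (edge i)) Sign.-
  D j = blocks Sign.- (opposite ∘ χ (triple j)) Sign.+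

  E : Cube n
  E = blocks Sign.- (λ _ → Sign.+) Sign.-

  L : List (Cube n)
  L = List.tabulate A ++ (List.tabulate D ++ (E ∷ []))

  A-spare : ∀ i s → lookup (A i) (spare s) ≡ Sign.+
  A-spare i s = at-spare Sign.+ (χ (edge i)) Sign.- s

  A-ring : ∀ i p → lookup (A i) (ring p) ≡ χ (edge i) p
  A-ring i p = at-ring Sign.+ (χ (edge i)) Sign.- p

  A-outer : ∀ i u → lookup (A i) (outer u) ≡ Sign.-
  A-outer i u = at-outer Sign.+ (χ (edge i)) Sign.- u

  D-spare : ∀ j s → lookup (D j) (spare s) ≡ Sign.-
  D-spare j s = at-spare Sign.- (opposite ∘ χ (triple j)) Sign.+ s

  D-ring : ∀ j p → lookup (D j) (ring p) ≡ opposite (χ (triple j) p)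
  D-ring j p = at-ring Sign.- (opposite ∘ χ (triple j)) Sign.+ p

  D-outer : ∀ j u → lookup (D j) (outer u) ≡ Sign.+
  D-outer j u = at-outer Sign.- (opposite ∘ χ (triple j)) Sign.+ u

  E-spare : ∀ s → lookup E (spare s) ≡ Sign.-
  E-spare = at-spare Sign.- (λ _ → Sign.+) Sign.-

  E-ring : ∀ p → lookup E (ring p) ≡ Sign.+
  E-ring = at-ring Sign.- (λ _ → Sign.+) Sign.-

  E-outer : ∀ u → lookup E (outer u) ≡ Sign.-
  E-outer = at-outer Sign.- (λ _ → Sign.+) Sign.-

  data Member : Cube n → Set where
    isA : ∀ i → Member (A i)
    isD : ∀ j → Member (D j)
    isE : Member E

  member⁻ : ∀ {B} → B ∈ L → Member B
  member⁻ B∈ with ∈-++⁻ (List.tabulate A) B∈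
  ... | inj₁ ∈A with ∈-tabulate⁻ {f = A} ∈A
  ...   | i , refl = isA i
  member⁻ B∈ | inj₂ ∈DE with ∈-++⁻ (List.tabulate D) ∈DE
  ...   | inj₁ ∈D with ∈-tabulate⁻ {f = D} ∈D
  ...     | j , refl = isD j
  member⁻ B∈ | inj₂ ∈DE | inj₂ (here refl) = isE

  A∈L : ∀ i → A i ∈ L
  A∈L i = ∈-++⁺ˡ (∈-tabulate⁺ {f = A} i)

  E∈L : E ∈ L
  E∈L = ∈-++⁺ʳ (List.tabulate A) (∈-++⁺ʳ (List.tabulate D) (here refl))

  -- Here `m = k + 2` is at least 7. Rotations by 1, 3 and 5 keep edges out of triples, and those by
  -- 2, 4 and 6 tell triples apart.
  free : ∀ a .{{_ : NonZero a}} → a ≤ 6 → ∀ {i : Fin m} → τ a i ≢ i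
  free a a≤6 = τ-free a (ℕ.≤-trans (s≤s a≤6) (s≤s (s≤s 5≤k))) _

  free₁ : ∀ {i : Fin m} → τ 1 i ≢ i
  free₁ = free 1 (s≤s z≤n)
  free₂ : ∀ {i : Fin m} → τ 2 i ≢ i
  free₂ = free 2 (ℕ.m≤m+n 2 4)
  free₃ : ∀ {i : Fin m} → τ 3 i ≢ i
  free₃ = free 3 (ℕ.m≤m+n 3 3)
  free₄ : ∀ {i : Fin m} → τ 4 i ≢ i
  free₄ = free 4 (ℕ.m≤m+n 4 2)
  free₅ : ∀ {i : Fin m} → τ 5 i ≢ i
  free₅ = free 5 (ℕ.m≤m+n 5 1)
  free₆ : ∀ {i : Fin m} → τ 6 i ≢ i
  free₆ = free 6 ℕ.≤-refl

  -- Sizes and degrees.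

  edge-unique : ∀ i → Unique (edge i)
  edge-unique i = ((free₁ ∘ sym) ∷ []) ∷ [] ∷ []

  triple-unique : ∀ j → Unique (triple j)
  -- `τ 4 j` computes to `τ 2 (τ 2 j)`, so `free₂` at the base point `τ 2 j` separates the last two
  -- entries.
  triple-unique j = ((free₂ ∘ sym) ∷ (free₄ ∘ sym) ∷ []) ∷ ((free₂ ∘ sym) ∷ []) ∷ [] ∷ []

  χ-edge : ∀ i p → ι (χ (edge i) p) ≡ δ p i ℕ.+ δ p (τ 1 i)
  χ-edge i p = trans (χ-δ (edge-unique i) p) (cong (δ p i ℕ.+_) (ℕ.+-identityʳ _))

  -- The ring part of `D j` is the complement of a triple; the additive form avoids truncated
  -- subtraction.
  χ-triple : ∀ j p →
    ι (opposite (χ (triple j) p)) ℕ.+ (δ p j ℕ.+ (δ p (τ 2 j) ℕ.+ δ p (τ 4 j))) ≡ 1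
  χ-triple j p = begin
    co ℕ.+ (δ p j ℕ.+ (δ p (τ 2 j) ℕ.+ δ p (τ 4 j)))
      ≡⟨ cong (λ d → co ℕ.+ (δ p j ℕ.+ (δ p (τ 2 j) ℕ.+ d))) (ℕ.+-identityʳ _) ⟨
    co ℕ.+ ℕΣ.∑[ triple j ] (δ p)
      ≡⟨ cong (co ℕ.+_) (χ-δ (triple-unique j) p) ⟨
    co ℕ.+ ι (χ (triple j) p)
      ≡⟨ ι-opposite (χ (triple j) p) ⟩
    1 ∎
    where
    open ≡-Reasoning
    co : ℕ
    co = ι (opposite (χ (triple j) p))
    ι-opposite : ∀ s → ι (opposite s) ℕ.+ ι s ≡ 1
    ι-opposite Sign.+ = refl
    ι-opposite Sign.- = refl

  zeros : sum {m} (λ _ → 0) ≡ 0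
  zeros = trans (sum-constant m 0) (ℕ.*-zeroʳ m)

  ones : sum {m} (λ _ → 1) ≡ m
  ones = trans (sum-constant m 1) (ℕ.*-identityʳ m)

  -- Stated for arbitrary functions, like `sum-triple`, so that it covers both the sum over
  -- positions for a fixed member, its size, and the sum over members for a fixed position, its
  -- degree.
  sum-edge : ∀ (f g h : Fin m → ℕ) → (∀ p → f p ≡ g p ℕ.+ h p) →
             sum g ≡ 1 → sum h ≡ 1 → sum f ≡ 2
  sum-edge f g h f≡ Σg Σh =
    trans (sum-cong-≗ f≡) (trans (∑-distrib-+ g h) (cong₂ ℕ._+_ Σg Σh))

  sum-triple : ∀ (f g h l : Fin m → ℕ) → (∀ p → f p ℕ.+ (g p ℕ.+ (h p ℕ.+ l p)) ≡ 1) →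
               sum g ≡ 1 → sum h ≡ 1 → sum l ≡ 1 → sum f ℕ.+ 3 ≡ m
  sum-triple f g h l total≡1 Σg Σh Σl = begin
    sum f ℕ.+ 3
      ≡⟨ cong (sum f ℕ.+_) (cong₂ ℕ._+_ Σg (cong₂ ℕ._+_ Σh Σl)) ⟨
    sum f ℕ.+ (sum g ℕ.+ (sum h ℕ.+ sum l))
      ≡⟨ cong (λ s → sum f ℕ.+ (sum g ℕ.+ s)) (∑-distrib-+ h l) ⟨
    sum f ℕ.+ (sum g ℕ.+ sum (λ p → h p ℕ.+ l p))
      ≡⟨ cong (sum f ℕ.+_) (∑-distrib-+ g (λ p → h p ℕ.+ l p)) ⟨
    sum f ℕ.+ sum (λ p → g p ℕ.+ (h p ℕ.+ l p))
      ≡⟨ ∑-distrib-+ f (λ p → g p ℕ.+ (h p ℕ.+ l p)) ⟨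
    sum (λ p → f p ℕ.+ (g p ℕ.+ (h p ℕ.+ l p)))
      ≡⟨ sum-cong-≗ total≡1 ⟩
    sum {m} (λ _ → 1)
      ≡⟨ ones ⟩
    m ∎
    where open ≡-Reasoning

  edge-size : ∀ i → sum (ι ∘ χ (edge i)) ≡ 2
  edge-size i = sum-edge (ι ∘ χ (edge i)) (λ p → δ p i) (λ p → δ p (τ 1 i))
    (χ-edge i) (sum-δ i) (sum-δ (τ 1 i))

  triple-cosize : ∀ j → sum (ι ∘ opposite ∘ χ (triple j)) ℕ.+ 3 ≡ m
  triple-cosize j = sum-triple (ι ∘ opposite ∘ χ (triple j))
    (λ p → δ p j) (λ p → δ p (τ 2 j)) (λ p → δ p (τ 4 j))
    (χ-triple j) (sum-δ j) (sum-δ (τ 2 j)) (sum-δ (τ 4 j))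

  edge-degree : ∀ p → sum (λ i → ι (χ (edge i) p)) ≡ 2
  edge-degree p = sum-edge (λ i → ι (χ (edge i) p)) (λ i → δ p i) (λ i → δ p (τ 1 i))
    (λ i → χ-edge i p) (sum-δ-τ 0 p) (sum-δ-τ 1 p)

  triple-codegree : ∀ p → sum (λ j → ι (opposite (χ (triple j) p))) ℕ.+ 3 ≡ m
  triple-codegree p = sum-triple (λ j → ι (opposite (χ (triple j) p)))
    (λ j → δ p j) (λ j → δ p (τ 2 j)) (λ j → δ p (τ 4 j))
    (λ j → χ-triple j p) (sum-δ-τ 0 p) (sum-δ-τ 2 p) (sum-δ-τ 4 p)

  weight-member : ∀ {B} → Member B → weight B ≡ m
  weight-member (isA i) = begin
    weight (A i)                                    ≡⟨ weight-blocks Sign.+ (χ (edge i)) Sign.- ⟩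
    k ℕ.* 1 ℕ.+ (sum (ι ∘ χ (edge i)) ℕ.+ 0)        ≡⟨ cong₂ (λ a b → a ℕ.+ (b ℕ.+ 0)) (ℕ.*-identityʳ k) (edge-size i) ⟩
    k ℕ.+ 2                                         ≡⟨ ℕ.+-comm k 2 ⟩
    m                                               ∎
    where open ≡-Reasoning
  weight-member (isD j) = begin
    weight (D j)                                              ≡⟨ weight-blocks Sign.- (opposite ∘ χ (triple j)) Sign.+ ⟩
    k ℕ.* 0 ℕ.+ (sum (ι ∘ opposite ∘ χ (triple j)) ℕ.+ 3)     ≡⟨ cong₂ ℕ._+_ (ℕ.*-zeroʳ k) (triple-cosize j) ⟩
    m                                                         ∎
    where open ≡-Reasoning
  weight-member isE = begin
    weight E                                        ≡⟨ weight-blocks Sign.- (λ _ → Sign.+) Sign.- ⟩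
    k ℕ.* 0 ℕ.+ (sum {m} (λ _ → 1) ℕ.+ 0)           ≡⟨ cong₂ (λ a b → a ℕ.+ (b ℕ.+ 0)) (ℕ.*-zeroʳ k) ones ⟩
    m ℕ.+ 0                                         ≡⟨ ℕ.+-identityʳ m ⟩
    m                                               ∎
    where open ≡-Reasoning

  degree-split : ∀ v → degree L v ≡
    sum (λ i → ι (lookup (A i) v)) ℕ.+ (sum (λ j → ι (lookup (D j) v)) ℕ.+ ι (lookup E v))
  degree-split v =
    trans (ℕΣ.Σ-++ (List.tabulate A) _ at-v) (cong₂ ℕ._+_ (Σ-tabulate A at-v)
    (trans (ℕΣ.Σ-++ (List.tabulate D) _ at-v) (cong₂ ℕ._+_ (Σ-tabulate D at-v) (ℕ.+-identityʳ _))))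
    where
    at-v : Cube n → ℕ
    at-v B = ι (lookup B v)

  column : ∀ (B : Fin m → Cube n) v f → (∀ i → lookup (B i) v ≡ f i) →
           sum (λ i → ι (lookup (B i) v)) ≡ sum (ι ∘ f)
  column B v f eq = sum-cong-≗ (cong ι ∘ eq)

  -- A spare voter lies in all `m` sets `A i` only, an outer voter in all `m` sets `D j` only, and a
  -- ring voter in two `A i`, in `m - 3` of the `D j` and in `E`.
  degree-voter : ∀ {v} → Voter v →
    sum (λ i → ι (lookup (A i) v)) ℕ.+ (sum (λ j → ι (lookup (D j) v)) ℕ.+ ι (lookup E v)) ≡ m
  degree-voter (isSpare s) = trans
    (cong₂ ℕ._+_
      (trans (column A (spare s) (λ _ → Sign.+) (λ i → A-spare i s)) ones)
      (cong₂ ℕ._+_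
        (trans (column D (spare s) (λ _ → Sign.-) (λ j → D-spare j s)) zeros)
        (cong ι (E-spare s))))
    (ℕ.+-identityʳ m)
  degree-voter (isRing p) = trans
    (cong₂ ℕ._+_
      (trans (column A (ring p) (λ i → χ (edge i) p) (λ i → A-ring i p)) (edge-degree p))
      (cong₂ ℕ._+_
        (column D (ring p) (λ j → opposite (χ (triple j) p)) (λ j → D-ring j p))
        (cong ι (E-ring p))))
    (trans (rearrange (sum (λ j → ι (opposite (χ (triple j) p))))) (triple-codegree p))
    where
    rearrange : ∀ s → 2 ℕ.+ (s ℕ.+ 1) ≡ s ℕ.+ 3
    rearrange = solve 1 (λ s → con 2 :+ (s :+ con 1) := s :+ con 3) refl
      where open ℕ.+-*-Solver
  degree-voter (isOuter u) = trans
    (cong₂ ℕ._+_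
      (trans (column A (outer u) (λ _ → Sign.-) (λ i → A-outer i u)) zeros)
      (cong₂ ℕ._+_
        (trans (column D (outer u) (λ _ → Sign.+) (λ j → D-outer j u)) ones)
        (cong ι (E-outer u))))
    (ℕ.+-identityʳ m)

  regular : ∀ i j → degree L i ≡ degree L j
  regular i j = trans (degree-L i) (sym (degree-L j))
    where
    degree-L : ∀ v → degree L v ≡ m
    degree-L v = trans (degree-split v) (degree-voter (voter v))

  -- Distinctness of the members.

  spare₀ : Fin k
  spare₀ = Fin.fromℕ< (ℕ.≤-trans (s≤s z≤n) 5≤k)

  differ : ∀ {B C : Cube n} v → lookup B v ≡ Sign.+ → lookup C v ≡ Sign.- → B ≢ C
  differ v B⁺ C⁻ refl = contradiction (trans (sym B⁺) C⁻) λ ()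

  -- Equality puts `i` in `edge j` and `j` in `edge i`; if `i` and `j` differed, a rotation by 1 or
  -- 2 would have a fixed point.
  A-injective : ∀ {i j} → A i ≡ A j → i ≡ j
  A-injective {i} {j} e = by-cases (incident e) (incident (sym e))
    where
    incident : ∀ {i j} → A i ≡ A j → i ∈ edge j
    incident {i} {j} e = χ⁻ (trans (sym (A-ring j i))
      (trans (cong (λ x → lookup x (ring i)) (sym e))
      (trans (A-ring i i) (χ-∈ {ps = edge i} (here refl)))))

    by-cases : i ∈ edge j → j ∈ edge i → i ≡ j
    by-cases (here i≡j)           _                      = i≡j
    by-cases (there (here refl)) (here j≡τj)            = contradiction (sym j≡τj) free₁
    by-cases (there (here refl)) (there (here j≡ττj)) = contradiction (sym j≡ττj) free₂

  -- Equality puts `i` in `triple j`. Were `i` equal to `τ 2 j` or `τ 4 j`, then `τ 6 j`, being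
  -- `τ 4 i` or `τ 2 i`, would lie in `triple i` but not in `triple j`.
  D-injective : ∀ {i j} → D i ≡ D j → i ≡ j
  D-injective {i} {j} e = by-cases (incident (here refl))
    where
    incident : ∀ {p} → p ∈ triple i → p ∈ triple j
    incident {p} p∈ = χ⁻ (trans (Sign.opposite-injective
      (trans (sym (D-ring j p)) (trans (cong (λ x → lookup x (ring p)) (sym e)) (D-ring i p))))
      (χ-∈ p∈))

    τ₆∉ : τ 6 j ∉ triple j
    τ₆∉ (here e)                 = free₆ e
    τ₆∉ (there (here e))         = free₄ e
    τ₆∉ (there (there (here e))) = free₂ e

    by-cases : i ∈ triple j → i ≡ j
    by-cases (here i≡j)                  = i≡j
    by-cases (there (here refl))         = contradiction (incident (there (there (here refl)))) τ₆∉
    by-cases (there (there (here refl))) = contradiction (incident (there (here refl))) τ₆∉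

  unique : Unique L
  unique = Unique.++⁺ (Unique.tabulate⁺ A-injective)
    (Unique.++⁺ (Unique.tabulate⁺ D-injective) ([] ∷ []) D-apart) A-apart
    where
    D-apart : ∀ {B} → ¬ (B ∈ List.tabulate D × B ∈ E ∷ [])
    D-apart (∈D , here refl) with ∈-tabulate⁻ {f = D} ∈D
    ... | j , E≡D = differ (outer 0F) (D-outer j 0F) (E-outer 0F) (sym E≡D)

    A-apart : ∀ {B} → ¬ (B ∈ List.tabulate A × B ∈ List.tabulate D ++ E ∷ [])
    A-apart (∈A , ∈DE) with ∈-tabulate⁻ {f = A} ∈A | ∈-++⁻ (List.tabulate D) ∈DE
    ... | i , B≡A | inj₂ (here B≡E) =
      differ (spare spare₀) (A-spare i spare₀) (E-spare spare₀) (trans (sym B≡A) B≡E)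
    ... | i , B≡A | inj₁ ∈D with ∈-tabulate⁻ {f = D} ∈D
    ...   | j , B≡D = differ (outer 0F) (D-outer j 0F) (A-outer i 0F) (trans (sym B≡D) B≡A)

  -- Pairwise intersections.

  open DecMembership (Fin._≟_ {m}) using () renaming (_∈?_ to _∈ᶠ?_)

  τ₁∉triple : ∀ j → τ 1 j ∉ triple j
  τ₁∉triple j (here e)                 = free₁ e
  τ₁∉triple j (there (here e))         = free₁ (sym e)
  τ₁∉triple j (there (there (here e))) = free₃ (sym e)

  -- The offsets 0, 2 and 4 are all even, so a neighbour inside the triple would give a rotation by
  -- 1, 3 or 5 with a fixed point.
  triple-independent : ∀ {i j} → i ∈ triple j → τ 1 i ∉ triple j
  triple-independent {j = j} (here refl)                 e                        = τ₁∉triple j e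
  triple-independent         (there (here refl))         (here e)                 = free₃ e
  triple-independent         (there (here refl))         (there (here e))         = free₁ e
  triple-independent         (there (here refl))         (there (there (here e))) = free₁ (sym e)
  triple-independent         (there (there (here refl))) (here e)                 = free₅ e
  triple-independent         (there (there (here refl))) (there (here e))         = free₃ e
  triple-independent         (there (there (here refl))) (there (there (here e))) = free₁ e

  edge⊈triple : ∀ i j → ∃[ p ] (p ∈ edge i × p ∉ triple j)
  edge⊈triple i j with i ∈ᶠ? triple j
  ... | yes i∈ = τ 1 i , there (here refl) , triple-independent i∈
  ... | no  i∉ = i , here refl , i∉

  ring∈A : ∀ {i p} → p ∈ edge i → lookup (A i) (ring p) ≡ Sign.+
  ring∈A {i} {p} p∈ = trans (A-ring i p) (χ-∈ p∈)

  ring∉A : ∀ {i p} → p ∉ edge i → lookup (A i) (ring p) ≡ Sign.-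
  ring∉A {i} {p} p∉ = trans (A-ring i p) (χ-∉ p∉)

  ring∈D : ∀ {j p} → p ∉ triple j → lookup (D j) (ring p) ≡ Sign.+
  ring∈D {j} {p} p∉ = trans (D-ring j p) (cong opposite (χ-∉ p∉))

  Meet : Cube n → Cube n → Set
  Meet B C = ∃[ v ] (lookup B v ≡ Sign.+ × lookup C v ≡ Sign.+)

  A-meets-D : ∀ i j → Meet (A i) (D j)
  A-meets-D i j with edge⊈triple i j
  ... | p , p∈ , p∉ = ring p , ring∈A p∈ , ring∈D p∉

  A-meets-E : ∀ i → Meet (A i) E
  A-meets-E i = ring i , ring∈A {i} (here refl) , E-ring i

  D-meets-E : ∀ j → Meet (D j) E
  D-meets-E j = ring (τ 1 j) , ring∈D (τ₁∉triple j) , E-ring (τ 1 j)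

  -- Two sets `A` share the spare voters and two sets `D` the outer ones; all other pairs meet on
  -- the ring.
  members-meet : ∀ {B C} → Member B → Member C → Meet B C
  members-meet (isA i) (isA j) = spare spare₀ , A-spare i spare₀ , A-spare j spare₀
  members-meet (isA i) (isD j) = A-meets-D i j
  members-meet (isA i) isE     = A-meets-E i
  members-meet (isD j) (isA i) = Product.map₂ Product.swap (A-meets-D i j)
  members-meet (isD i) (isD j) = outer 0F , D-outer i 0F , D-outer j 0F
  members-meet (isD j) isE     = D-meets-E j
  members-meet isE     (isA i) = Product.map₂ Product.swap (A-meets-E i)
  members-meet isE     (isD j) = Product.map₂ Product.swap (D-meets-E j)
  members-meet isE     isE     = ring 0F , E-ring 0F , E-ring 0F

  open Perturbation n≡1+2m L unique (weight-member ∘ member⁻)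
    (λ B∈ C∈ → members-meet (member⁻ B∈) (member⁻ C∈)) public

  -- Twins and the failure of transitivity.

  outer-twins : ∀ {B} → Member B → lookup B (outer 0F) ≡ lookup B (outer 1F)
  outer-twins (isA i) = trans (A-outer i 0F) (sym (A-outer i 1F))
  outer-twins (isD j) = trans (D-outer j 0F) (sym (D-outer j 1F))
  outer-twins isE     = trans (E-outer 0F) (sym (E-outer 1F))

  -- This choice makes `p₀` the only common position of the explicit edges `edge 0F` and `edge p₀`,
  -- so each other ring voter is missed by one of them.
  p₀ : Fin m
  p₀ = τ 1 0F

  Separated : Fin n → Set
  Separated v = ∃[ B ] (B ∈ L × lookup B (ring p₀) ≡ Sign.+ × lookup B v ≡ Sign.-)

  ring-separated : ∀ q → q ≢ p₀ → Separated (ring q)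
  ring-separated q q≢p₀ with q ∈ᶠ? edge 0F
  ... | no q∉                    = A 0F , A∈L 0F , ring∈A {0F} (there (here refl)) , ring∉A {0F} q∉
  ... | yes (there (here q≡p₀)) = contradiction q≡p₀ q≢p₀
  ... | yes (here refl)          = A p₀ , A∈L p₀ , ring∈A {p₀} (here refl) , ring∉A {p₀} 0∉
    where
    0∉ : 0F ∉ edge p₀
    0∉ (here e)         = free₁ (sym e)
    0∉ (there (here e)) = free₂ (sym e)

  -- `E` contains exactly the ring, so it separates `ring p₀` from spare and outer voters; another
  -- ring voter is separated by an edge through `p₀`.
  no-twin : ∀ {v} → Voter v → v ≢ ring p₀ → Separated v
  no-twin (isSpare i) v≢ = E , E∈L , E-ring p₀ , E-spare i
  no-twin (isRing q)  v≢ = ring-separated q (v≢ ∘ cong ring)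
  no-twin (isOuter u) v≢ = E , E∈L , E-ring p₀ , E-outer u

  outer-distinct : outer 1F ≢ outer 0F
  outer-distinct e = contradiction (Fin.↑ʳ-injective m 1F 0F (Fin.↑ʳ-injective k (m ↑ʳ 1F) (m ↑ʳ 0F) e)) λ ()

  -- Pulling a member `B` back along `σ` gives a member, in which the outer twins agree; hence `B`
  -- agrees at their images, and no `B` can separate those.
  twin-image : ∀ {σ} → aut Φ σ → σ ⟨$⟩ʳ outer 0F ≡ ring p₀ → ¬ Separated (σ ⟨$⟩ʳ outer 1F)
  twin-image {σ} fixes σ₀≡p₀ (B , B∈L , B-p₀ , B-σ₁) = contradiction
    (begin
      Sign.+                         ≡⟨ B-p₀ ⟨
      lookup B (ring p₀)             ≡⟨ cong (lookup B) σ₀≡p₀ ⟨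
      lookup B (σ ⟨$⟩ʳ outer 0F)     ≡⟨ moved (outer 0F) ⟨
      lookup (flip σ ∙ B) (outer 0F) ≡⟨ outer-twins (member⁻ (aut-preserves {σ} fixes B∈L)) ⟩
      lookup (flip σ ∙ B) (outer 1F) ≡⟨ moved (outer 1F) ⟩
      lookup B (σ ⟨$⟩ʳ outer 1F)     ≡⟨ B-σ₁ ⟩
      Sign.-                         ∎)
    λ ()
    where
    open ≡-Reasoning
    moved : ∀ v → lookup (flip σ ∙ B) v ≡ lookup B (σ ⟨$⟩ʳ v)
    moved = Vec.lookup∘tabulate (λ v → lookup B (σ ⟨$⟩ʳ v))

  not-transitive : ¬ TransitiveSymmetric Φ
  not-transitive transitive =
    let σ , fixes , σ₀≡p₀ = transitive (outer 0F) (ring p₀)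
        σ₁≢p₀ = λ σ₁≡p₀ → outer-distinct (Injection.injective (↔⇒↣ σ) (trans σ₁≡p₀ (sym σ₀≡p₀)))
    in twin-image {σ} fixes σ₀≡p₀ (no-twin (voter (σ ⟨$⟩ʳ outer 1F)) σ₁≢p₀)

-- With `n = 1 + 2h`, `h` is the `m` of the construction and `k = h - 2` counts the spare voters; 15
-- is the odd number at which `h` reaches 7, that is, `k` reaches 5.
odd-decomposition : ∀ n → n % 2 ≡ 1 → n ≥ 15 → ∃[ k ] (5 ≤ k × n ≡ k ℕ.+ (suc (suc k) ℕ.+ 3))
odd-decomposition n n%2≡1 n≥15 = k , ℕ.∸-monoˡ-≤ 2 7≤h , eq
  where
  h = n / 2
  n≡1+2h : n ≡ 1 ℕ.+ h ℕ.* 2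
  n≡1+2h = trans (m≡m%n+[m/n]*n n 2) (cong (ℕ._+ h ℕ.* 2) n%2≡1)
  7≤h : 7 ≤ h
  7≤h = ℕ.*-cancelʳ-≤ 7 h 2 (ℕ.s≤s⁻¹ (subst (15 ≤_) n≡1+2h n≥15))
  2≤h : 2 ≤ h
  2≤h = ℕ.≤-trans (s≤s (s≤s z≤n)) 7≤h
  k = h ∸ 2
  eq : n ≡ k ℕ.+ (suc (suc k) ℕ.+ 3)
  eq = trans n≡1+2h (trans (cong (λ j → 1 ℕ.+ j ℕ.* 2) (sym (ℕ.m+[n∸m]≡n 2≤h))) (rearrange k))
    where
    rearrange : ∀ k → 1 ℕ.+ (2 ℕ.+ k) ℕ.* 2 ≡ k ℕ.+ (2 ℕ.+ k ℕ.+ 3)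
    rearrange = solve 1 (λ k → con 1 :+ (con 2 :+ k) :* con 2 := k :+ (con 2 :+ k :+ con 3)) refl
      where open ℕ.+-*-Solver

theorem1 : Σ[ N ∈ ℕ ] (∀ (n : ℕ) → n % 2 ≡ 1 → n ≥ N →
    Σ[ Φ ∈ VotingRule n ] (Odd Φ × Monotone Φ × Unbiased Φ × ¬ TransitiveSymmetric Φ))
theorem1 = 15 , rule
  where
  rule : ∀ (n : ℕ) → n % 2 ≡ 1 → n ≥ 15 →
    Σ[ Φ ∈ VotingRule n ] (Odd Φ × Monotone Φ × Unbiased Φ × ¬ TransitiveSymmetric Φ)
  rule n n%2≡1 n≥15 with odd-decomposition n n%2≡1 n≥15
  ... | k , 5≤k , refl = Φ , odd , monotone , unbiased regular , not-transitive
    where open Construction k 5≤k
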